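{- The problem Uniform Cluster Edge Addition (UCEA), parameterized by the solution size $k$, admits a kernel with at most $5k$ vertices.
   Context: All graphs are finite, simple and undirected. A uniform cluster graph is a graph that is a disjoint union of cliques, all of the same size. UCEA: Input: a graph $G=(V,E)$ and a positive integer $k$. Question: is there a set $F\subseteq\binom{V}{2}$ with $|F|\le k$ such that $G+F=(V,E\cup F)$ is a uniform cluster graph? A kernel with at most $f(k)$ vertices for a parameterized graph problem is a polynomial-time algorithm that maps every instance $(G,k)$ to an instance $(G',k')$ of the same problem such that $(G,k)$ is a yes-instance if and only if $(G',k')$ is a yes-instance, $|V(G')|\le f(k)$, and $k'$ is bounded by a computable function of $k$. -}

module Defs where

open import Data.Bool.Base using (Bool; true; false; _∨_; if_then_else_)
open import Data.Bool.Properties using (T?)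
open import Data.Fin.Base using (Fin; toℕ; fromℕ<)
open import Data.Fin.Properties using (_<?_) renaming (_≟_ to _≟ᶠ_)
open import Data.Fin.Subset using (Subset; ∣_∣)
open import Data.List.Base using (List; allFin; cartesianProduct; filter; length)
open import Data.Nat.Base using (ℕ; zero; suc; _+_; _*_; _∸_; _^_; _≤_; _>_)
open import Data.Nat.Logarithm using (⌊log₂_⌋)
open import Data.Nat.Properties using (_≟_) renaming (_<?_ to _<ℕ?_)
open import Data.Product.Base using (Σ-syntax; ∃-syntax; _×_; _,_)
open import Data.Vec.Base using (tabulate)
open import Function.Bundles using (_⇔_)
open import Relation.Binary.PropositionalEquality using (_≡_; _≢_; cong₂)
open import Relation.Nullary.Decidable using (yes; no; does; _×-dec_)

------------------------------------------------------------------------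
-- Graphs

-- A set of two-element subsets of Fin n, as a symmetric irreflexive relation.
record EdgeSet (n : ℕ) : Set where
  field
    adj    : Fin n → Fin n → Bool
    sym    : ∀ u v → adj u v ≡ adj v u
    irrefl : ∀ v → adj v v ≡ false

open EdgeSet public

-- Simple graphs with vertex set Fin n.
Graph : ℕ → Set
Graph = EdgeSet

_∪ₑ_ : ∀ {n} → EdgeSet n → EdgeSet n → EdgeSet n
(E ∪ₑ F) .adj u v  = adj E u v ∨ adj F u v
(E ∪ₑ F) .sym u v  = cong₂ _∨_ (sym E u v) (sym F u v)
(E ∪ₑ F) .irrefl v = cong₂ _∨_ (irrefl E v) (irrefl F v)

-- Each pair {u , v} is listed once, as (u , v) with u < v.
edges : ∀ {n} → EdgeSet n → List (Fin n × Fin n)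
edges {n} E =
  filter (λ (u , v) → (u <? v) ×-dec T? (adj E u v))
         (cartesianProduct (allFin n) (allFin n))

∣_∣ₑ : ∀ {n} → EdgeSet n → ℕ
∣ E ∣ₑ = length (edges E)

fibre : ∀ {n m} → (Fin n → Fin m) → Fin m → Subset n
fibre c i = tabulate λ v → does (c v ≟ᶠ i)

-- The cliques are the non-empty fibres of c; s is their common size.
UniformCluster : ∀ {n} → Graph n → Set
UniformCluster {n} G =
  ∃[ s ] ∃[ m ] Σ[ c ∈ (Fin n → Fin m) ]
    (∀ u v → adj G u v ≡ true ⇔ (u ≢ v × c u ≡ c v)) ×
    (∀ v → ∣ fibre c (c v) ∣ ≡ s)

------------------------------------------------------------------------
-- Parameterized graph problems

record Instance : Set where
  field
    order : ℕ
    graph : Graph order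
    param : ℕ
    param>0 : param > 0

open Instance public

GraphProblem : Set₁
GraphProblem = Instance → Set

UCEA : GraphProblem
UCEA I = Σ[ F ∈ EdgeSet (order I) ]
  ∣ F ∣ₑ ≤ param I × UniformCluster (graph I ∪ₑ F)

------------------------------------------------------------------------
-- Random access machines, as while programs over number variables and
-- two-dimensional arrays of numbers.  The arithmetic operations are addition
-- and truncated subtraction, at unit cost.  Multiplication is deliberately
-- absent: without it bit lengths grow at most linearly with the running time,
-- so polynomial time here agrees with polynomial time on Turing machines.

Name : Set
Name = ℕ

infixl 6 _⊕_ _⊖_

data Expr : Set where
  lit     : ℕ → Expr
  var     : Name → Expr
  _[_,_]  : Name → Expr → Expr → Expr
  _⊕_ _⊖_ : Expr → Expr → Expr

infix  5 _≔_ _[_,_]≔_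
infixr 4 _⨾_

-- A condition is true when its value is non-zero.
data Prog : Set where
  skip          : Prog
  _≔_           : Name → Expr → Prog
  _[_,_]≔_      : Name → Expr → Expr → Expr → Prog
  _⨾_           : Prog → Prog → Prog
  If_Then_Else_ : Expr → Prog → Prog → Prog
  While_Do_     : Expr → Prog → Prog

record State : Set where
  field
    vars   : Name → ℕ
    arrays : Name → ℕ → ℕ → ℕ

open State public

setVar : Name → ℕ → State → State
setVar x k σ .vars y   = if does (y ≟ x) then k else vars σ y
setVar x k σ .arrays   = arrays σ

setCell : Name → ℕ → ℕ → ℕ → State → State
setCell a i j k σ .vars         = vars σ
setCell a i j k σ .arrays b p q =
  if does ((b ≟ a) ×-dec ((p ≟ i) ×-dec (q ≟ j))) then k else arrays σ b p q

eval : State → Expr → ℕ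
eval σ (lit k)       = k
eval σ (var x)       = vars σ x
eval σ (a [ d , e ]) = arrays σ a (eval σ d) (eval σ e)
eval σ (d ⊕ e)       = eval σ d + eval σ e
eval σ (d ⊖ e)       = eval σ d ∸ eval σ e

cost : Expr → ℕ
cost (lit k)       = 1
cost (var x)       = 1
cost (a [ d , e ]) = suc (cost d + cost e)
cost (d ⊕ e)       = suc (cost d + cost e)
cost (d ⊖ e)       = suc (cost d + cost e)

infix 3 _,_⇓[_]_

-- P , σ ⇓[ t ] τ : started in σ, P halts in τ after t steps.
data _,_⇓[_]_ : Prog → State → ℕ → State → Set where
  skip : ∀ {σ} →
    skip , σ ⇓[ 1 ] σ
  assign : ∀ {σ x e} →
    (x ≔ e) , σ ⇓[ suc (cost e) ] setVar x (eval σ e) σ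
  store : ∀ {σ a d e f} →
    (a [ d , e ]≔ f) , σ ⇓[ suc (cost d + cost e + cost f) ]
      setCell a (eval σ d) (eval σ e) (eval σ f) σ
  seq : ∀ {σ τ υ P Q s t} →
    P , σ ⇓[ s ] τ → Q , τ ⇓[ t ] υ → (P ⨾ Q) , σ ⇓[ s + t ] υ
  if-true : ∀ {σ τ e P Q t} →
    eval σ e ≢ 0 → P , σ ⇓[ t ] τ →
    (If e Then P Else Q) , σ ⇓[ suc (cost e + t) ] τ
  if-false : ∀ {σ τ e P Q t} →
    eval σ e ≡ 0 → Q , σ ⇓[ t ] τ →
    (If e Then P Else Q) , σ ⇓[ suc (cost e + t) ] τ
  while-true : ∀ {σ τ υ e P s t} →
    eval σ e ≢ 0 → P , σ ⇓[ s ] τ → (While e Do P) , τ ⇓[ t ] υ →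
    (While e Do P) , σ ⇓[ suc (cost e + s + t) ] υ
  while-false : ∀ {σ e P} →
    eval σ e ≡ 0 → (While e Do P) , σ ⇓[ suc (cost e) ] σ

-- Input and output of a number: variable 0.
numberInput : ℕ → State
numberInput k .vars 0       = k
numberInput k .vars (suc _) = 0
numberInput k .arrays _ _ _ = 0

Computable : (ℕ → ℕ) → Set
Computable g = Σ[ P ∈ Prog ] (∀ k → ∃[ t ] ∃[ τ ]
  (P , numberInput k ⇓[ t ] τ) × vars τ 0 ≡ g k)

-- Input and output of an instance: variable 0 holds the number of vertices,
-- variable 1 the parameter and array 0 the adjacency matrix.
bit : Bool → ℕ
bit b = if b then 1 else 0

matrix : ∀ {n} → Graph n → ℕ → ℕ → ℕ
matrix {n} G i j with i <ℕ? n | j <ℕ? n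
... | yes i<n | yes j<n = bit (adj G (fromℕ< i<n) (fromℕ< j<n))
... | _       | _       = 0

input : Instance → State
input I .vars 0             = order I
input I .vars 1             = param I
input I .vars (suc (suc _)) = 0
input I .arrays 0           = matrix (graph I)
input I .arrays (suc _) _ _ = 0

record Outputs (τ : State) (I : Instance) : Set where
  field
    order≡ : vars τ 0 ≡ order I
    param≡ : vars τ 1 ≡ param I
    graph≡ : ∀ u v → arrays τ 0 (toℕ u) (toℕ v) ≡ bit (adj (graph I) u v)

-- The length of the adjacency matrix and of the parameter in binary.
size : Instance → ℕ
size I = order I * order I + suc ⌊log₂ param I ⌋

------------------------------------------------------------------------
-- Kernels

-- Every polynomial is bounded by one of the form c * xᵈ + c.
HasKernelWithVertices : GraphProblem → (ℕ → ℕ) → Set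
HasKernelWithVertices Q f =
  Σ[ P ∈ Prog ] ∃[ c ] ∃[ d ] Σ[ g ∈ (ℕ → ℕ) ] Computable g ×
    (∀ I → ∃[ t ] ∃[ τ ] Σ[ I′ ∈ Instance ]
      (P , input I ⇓[ t ] τ) ×
      Outputs τ I′ ×
      t ≤ c * size I ^ d + c ×
      (Q I ⇔ Q I′) ×
      order I′ ≤ f (param I) ×
      param I′ ≤ g (param I))

{-# OPTIONS --safe #-}
-- Write N[v] for closed neighbourhoods and deg v = |N[v]|.  A graph can be
-- completed to cliques of size s with at most k edges iff its vertices can be
-- partitioned into classes of size s that no edge crosses (a packing), and
-- Σ (s − deg v) ≤ 2k.  With more than 2k vertices some vertex has deg v = s, so s
-- is the maximum degree.  Call v good if deg v = s and N[v] is a component; in a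
-- yes-instance at most 2k vertices are not good.  Deleting N[v] for good v does not
-- affect packings.  Do so as long as more than 5k vertices remain.  If then still
-- more than 5k remain, the instance is a no-instance.  If between 2k and 5k remain,
-- s is still determined and the rest is the kernel.  If at most 2k remain, then
-- s > 3k, so there is a packing only if nothing remains.
module Submission where

-- The component `N[v]` of a good vertex `v` need not be a clique. Deleting it may therefore discard
-- part of the deficit while the parameter stays k, so the program itself tests the deficit of the
-- whole graph against 2k. After that test only packings have to be carried between the graph and
-- the kernel. Deficits never grow on the way, so more than 2k remaining vertices determine the
-- clique size in the kernel too.
--
-- Goodness refers to the original graph, and deletions change neither degrees nor neighbourhoods of
-- what remains; hence a single pass over the vertices is enough. Every deletion starts from more
-- than 5k vertices and removes s of them, so s plus the number of survivors always exceeds 5k. This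
-- is the source of s > 3k, whereas a class among at most 2k survivors would have at most 2k
-- vertices. A rejected instance is replaced by a fixed no-instance on three vertices, which fits
-- because k is positive.
--
-- A kernel has to be an explicit machine program with a step count. To keep this manageable, the
-- program is built from bounded loops with a total semantics, and the part of the state that it
-- preserves is computed from its syntax.

open import Defs renaming (sym to adj-sym; irrefl to adj-irrefl)
open import Data.Bool.Base using (Bool; true; false; not; _∧_; _∨_; if_then_else_; T)
open import Data.Bool.Properties using (T?)
open import Data.Empty using (⊥; ⊥-elim)
open import Data.Fin.Base as Fin using (Fin; toℕ; fromℕ<)
open import Data.Fin.Properties using (toℕ<n; fromℕ<-toℕ; toℕ-fromℕ<; toℕ-injective)
  renaming (_≟_ to _≟ᶠ_; _<?_ to _<?ᶠ_)
open import Data.Fin.Subset using (∣_∣)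
open import Data.List.Base as List using (_∷_; _++_; filter; length; cartesianProduct)
open import Data.List.Properties using (filter-++; length-++; map-tabulate)
open import Data.Nat.Base using (ℕ; zero; suc; _+_; _*_; _∸_; _^_; _≤_; _<_; z≤n; s≤s; s≤s⁻¹; _≡ᵇ_; _<ᵇ_)
open import Data.Nat.Properties
open import Data.Nat.Tactic.RingSolver using (solve-∀)
open import Data.Product.Base using (Σ-syntax; ∃-syntax; _×_; _,_; proj₁; proj₂)
open import Data.Sum.Base using (_⊎_; inj₁; inj₂)
open import Data.Vec.Base as Vec using ()
open import Function.Base using (id; _∘_)
open import Function.Bundles using (_⇔_; mk⇔; Equivalence)
open import Relation.Binary.Definitions using (tri<; tri≈; tri>)
open import Relation.Binary.PropositionalEquality hiding ([_])
open import Relation.Nullary.Decidable using (yes; no; does; dec-true; dec-false; _×-dec_)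
open import Relation.Nullary.Negation using (¬_; contradiction)
open import Relation.Unary using (Decidable)

-- For-programs

-- A total fragment of the machine language: every loop runs as often as
-- variable 0 says, provided that neither this variable nor the loop counter is
-- overwritten in its body.
infix  5 _:=_ _[_,_]:=_
infixr 4 _▸_

data Cmd : Set where
  _:=_       : Name → Expr → Cmd
  _[_,_]:=_  : Name → Expr → Expr → Expr → Cmd
  _▸_        : Cmd → Cmd → Cmd
  unless     : Expr → Cmd → Cmd
  for        : Name → Cmd → Cmd

increment : Name → Expr
increment x = lit 1 ⊕ var x

compile : Cmd → Prog
compile (x := e)           = x ≔ e
compile (a [ d , e ]:= f)  = a [ d , e ]≔ f
compile (C ▸ D)            = compile C ⨾ compile D
compile (unless e C)       = If e Then skip Else compile C
compile (for x C)          =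
  x ≔ lit 0 ⨾ While (var 0 ⊖ var x) Do (compile C ⨾ x ≔ increment x)

-- Boolean and purely syntactic, so that for a concrete program the claim that a variable or an
-- array is left alone is proved by `refl`.
writes : Cmd → Name → Bool
writes (x := e)          y = does (y ≟ x)
writes (a [ d , e ]:= f) y = false
writes (C ▸ D)           y = writes C y ∨ writes D y
writes (unless e C)      y = writes C y
writes (for x C)         y = does (y ≟ x) ∨ writes C y

fills : Cmd → Name → Bool
fills (x := e)          b = false
fills (a [ d , e ]:= f) b = does (b ≟ a)
fills (C ▸ D)           b = fills C b ∨ fills D b
fills (unless e C)      b = fills C b
fills (for x C)         b = fills C b

countersKept : Cmd → Bool
countersKept (x := e)          = true
countersKept (a [ d , e ]:= f) = true
countersKept (C ▸ D)           = countersKept C ∧ countersKept D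
countersKept (unless e C)      = countersKept C
countersKept (for x C)         = not (writes C x) ∧ countersKept C

ifZero : ∀ {A : Set} → ℕ → A → A → A
ifZero zero    a b = a
ifZero (suc _) a b = b

loop : ℕ → (State → State) → State → State
loop zero    f σ = σ
loop (suc j) f σ = loop j f (f σ)

tick : Name → State → State
tick x σ = setVar x (suc (vars σ x)) σ

-- The loop bound is the fixed number `n` and not variable 0 of the current state; this makes the
-- semantics structurally recursive. `exec` relates the two.
run : ℕ → Cmd → State → State
run n (x := e)          σ = setVar x (eval σ e) σ
run n (a [ d , e ]:= f) σ = setCell a (eval σ d) (eval σ e) (eval σ f) σ
run n (C ▸ D)           σ = run n D (run n C σ)
run n (unless e C)      σ = ifZero (eval σ e) (run n C σ) σ
run n (for x C)         σ = loop n (λ τ → tick x (run n C τ)) (setVar x 0 σ)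

∨-false : ∀ {a b} → a ∨ b ≡ false → a ≡ false × b ≡ false
∨-false {false} eq = refl , eq

∧-true : ∀ {a b} → a ∧ b ≡ true → a ≡ true × b ≡ true
∧-true {true} eq = refl , eq

not-true : ∀ {a} → not a ≡ true → a ≡ false
not-true {false} _ = refl

setVar-same : ∀ x k σ → vars (setVar x k σ) x ≡ k
setVar-same x k σ rewrite dec-true (x ≟ x) refl = refl

setVar-other : ∀ {x y} k σ → does (y ≟ x) ≡ false → vars (setVar x k σ) y ≡ vars σ y
setVar-other k σ eq rewrite eq = refl

setCell-same : ∀ a i j k σ → arrays (setCell a i j k σ) a i j ≡ k
setCell-same a i j k σ
  rewrite dec-true (a ≟ a) refl | dec-true (i ≟ i) refl | dec-true (j ≟ j) refl = refl

setCell-other-row : ∀ a {i} j k σ {p} q → p ≢ i → arrays (setCell a i j k σ) a p q ≡ arrays σ a p q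
setCell-other-row a {i} j k σ {p} q p≢i rewrite dec-true (a ≟ a) refl | dec-false (p ≟ i) p≢i = refl

setCell-other-column : ∀ a i {j} k σ p {q} → q ≢ j → arrays (setCell a i j k σ) a p q ≡ arrays σ a p q
setCell-other-column a i {j} k σ p {q} q≢j
  rewrite dec-true (a ≟ a) refl | dec-false (q ≟ j) q≢j with does (p ≟ i)
... | true  = refl
... | false = refl

record Frame (C : Cmd) (σ τ : State) : Set where
  constructor _,_
  field
    vars≡   : ∀ y → writes C y ≡ false → vars τ y ≡ vars σ y
    arrays≡ : ∀ a → fills C a ≡ false → ∀ p q → arrays τ a p q ≡ arrays σ a p q

open Frame public

infixr 4 _▸ᶠ_

_▸ᶠ_ : ∀ {C D σ τ υ} → Frame C σ τ → Frame D τ υ → Frame (C ▸ D) σ υ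
F ▸ᶠ G =
  (λ y eq → let (p , q) = ∨-false eq in trans (vars≡ G y q) (vars≡ F y p)) ,
  (λ a eq i j → let (p , q) = ∨-false eq in trans (arrays≡ G a q i j) (arrays≡ F a p i j))

frame : ∀ n C σ → Frame C σ (run n C σ)

-- The number `j` of rounds is independent of `n`, so this also covers states in the middle of a
-- loop.
frame-loop : ∀ n x C j σ → Frame (for x C) σ (loop j (λ τ → tick x (run n C τ)) σ)
frame-loop n x C zero    σ = (λ _ _ → refl) , (λ _ _ _ _ → refl)
frame-loop n x C (suc j) σ = let
  F = frame-loop n x C j (tick x (run n C σ))
  G = frame n C σ in
  (λ y eq → let (p , q) = ∨-false {does (y ≟ x)} eq in
     trans (vars≡ F y eq) (trans (setVar-other _ (run n C σ) p) (vars≡ G y q))) ,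
  (λ a eq p q → trans (arrays≡ F a eq p q) (arrays≡ G a eq p q))

frame n (x := e) σ = (λ y eq → setVar-other _ σ eq) , λ _ _ _ _ → refl
frame n (a [ d , e ]:= f) σ = (λ _ _ → refl) , helper
  where
  helper : ∀ b → does (b ≟ a) ≡ false → ∀ p q → arrays (run n (a [ d , e ]:= f) σ) b p q ≡ arrays σ b p q
  helper b eq p q rewrite eq = refl
frame n (C ▸ D) σ = frame n C σ ▸ᶠ frame n D (run n C σ)
frame n (unless e C) σ with eval σ e
... | zero  = frame n C σ .vars≡ , frame n C σ .arrays≡
... | suc _ = (λ _ _ → refl) , (λ _ _ _ _ → refl)
frame n (for x C) σ = let F = frame-loop n x C n (setVar x 0 σ) in
  (λ y eq → trans (vars≡ F y eq) (setVar-other 0 σ (proj₁ (∨-false {does (y ≟ x)} eq)))) ,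
  arrays≡ F

-- The step receives a frame back to `σ`, so that `Inv` need mention only what the loop changes.
for-rule : ∀ n x C σ (Inv : ℕ → State → Set) → writes C x ≡ false →
  Inv 0 (setVar x 0 σ) →
  (∀ i τ → i < n → vars τ x ≡ i → Frame (for x C) σ τ → Inv i τ →
     Inv (suc i) (tick x (run n C τ))) →
  Inv n (run n (for x C) σ)
for-rule n x C σ Inv kept start step =
  go n 0 (setVar x 0 σ) refl (setVar-same x 0 σ)
     ((λ y eq → setVar-other 0 σ (proj₁ (∨-false {does (y ≟ x)} eq))) , (λ _ _ _ _ → refl)) start
  where
  body = λ τ → tick x (run n C τ)
  go : ∀ j i τ → i + j ≡ n → vars τ x ≡ i → Frame (for x C) σ τ → Inv i τ → Inv n (loop j body τ)
  go zero    i τ eq x≡i F inv = subst (λ i → Inv i τ) (trans (sym (+-identityʳ i)) eq) inv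
  go (suc j) i τ eq x≡i F inv =
    go j (suc i) (body τ) (trans (sym (+-suc i j)) eq)
       (trans (setVar-same x _ (run n C τ)) (cong suc (trans (vars≡ (frame n C τ) x kept) x≡i)))
       ((λ y e → trans (vars≡ G y e) (vars≡ F y e)) ,
        (λ a e p q → trans (arrays≡ G a e p q) (arrays≡ F a e p q)))
       (step i τ (subst (i <_) eq (m<m+n i (s≤s z≤n))) x≡i F inv)
    where G = frame-loop n x C 1 τ

timeBound : Cmd → ℕ → ℕ
timeBound (x := e)          n = suc (cost e)
timeBound (a [ d , e ]:= f) n = suc (cost d + cost e + cost f)
timeBound (C ▸ D)           n = timeBound C n + timeBound D n
timeBound (unless e C)      n = suc (cost e + suc (timeBound C n))
-- Initialising the counter costs 2, the guard and the increment of each round 4 + 4, and the last,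
-- failing guard 4.
timeBound (for x C)         n = 2 + (n * (8 + timeBound C n) + 4)

exec : ∀ n C → countersKept C ≡ true → writes C 0 ≡ false → ∀ σ → vars σ 0 ≡ n →
  ∃[ t ] (compile C , σ ⇓[ t ] run n C σ) × t ≤ timeBound C n
exec n (x := e)          _ _ σ _ = _ , assign , ≤-refl
exec n (a [ d , e ]:= f) _ _ σ _ = _ , store , ≤-refl
exec n (C ▸ D) ok fix σ eq = let
  (okC , okD)   = ∧-true ok
  (fixC , fixD) = ∨-false fix
  (s , p , s≤)  = exec n C okC fixC σ eq
  (t , q , t≤)  = exec n D okD fixD (run n C σ) (trans (vars≡ (frame n C σ) 0 fixC) eq)
  in s + t , seq p q , +-mono-≤ s≤ t≤
exec n (unless e C) ok fix σ eq with eval σ e in val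
... | zero  = let (t , p , t≤) = exec n C ok fix σ eq in
  _ , if-false val p , s≤s (+-monoʳ-≤ (cost e) (m≤n⇒m≤1+n t≤))
... | suc _ = _ , if-true (λ z → 1+n≢0 (trans (sym val) z)) skip ,
  s≤s (+-monoʳ-≤ (cost e) (s≤s z≤n))
exec n (for x C) ok fix σ eq = let
  σ₀ = setVar x 0 σ
  (t , p , t≤) = iterate n 0 σ₀ refl (setVar-same x 0 σ) (trans (setVar-other {x} {0} 0 σ 0≢x) eq)
  in 2 + t , seq assign p , +-monoʳ-≤ 2 t≤
  where
  0≢x : does (0 ≟ x) ≡ false
  0≢x   = proj₁ (∨-false {does (0 ≟ x)} fix)
  fixC  = proj₂ (∨-false {does (0 ≟ x)} fix)
  keepx = not-true (proj₁ (∧-true {not (writes C x)} ok))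
  okC   = proj₂ (∧-true {not (writes C x)} ok)
  body  = λ τ → tick x (run n C τ)
  B     = timeBound C n
  iterate : ∀ j i τ → i + j ≡ n → vars τ x ≡ i → vars τ 0 ≡ n →
    ∃[ t ] ((While (var 0 ⊖ var x) Do (compile C ⨾ x ≔ increment x)) , τ ⇓[ t ] loop j body τ) ×
           t ≤ j * (8 + B) + 4
  iterate zero i τ e x≡i 0≡n =
    _ , while-false (trans (cong₂ _∸_ 0≡n (trans x≡i (trans (sym (+-identityʳ i)) e))) (n∸n≡0 n)) , ≤-refl
  iterate (suc j) i τ e x≡i 0≡n = let
    (s , p , s≤) = exec n C okC fixC τ 0≡n
    (t , q , t≤) = iterate j (suc i) (body τ) (trans (sym (+-suc i j)) e)
       (trans (setVar-same x _ (run n C τ)) (cong suc (trans (vars≡ (frame n C τ) x keepx) x≡i)))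
       (trans (setVar-other {x} {0} _ (run n C τ) 0≢x) (trans (vars≡ (frame n C τ) 0 fixC) 0≡n))
    in _ , while-true (λ z → <⇒≱ i<n (m∸n≡0⇒m≤n (subst₂ (λ a b → a ∸ b ≡ 0) 0≡n x≡i z)))
                      (seq p assign) q ,
       (begin
          4 + (s + 4) + t                  ≤⟨ +-mono-≤ (+-monoʳ-≤ 4 (+-monoˡ-≤ 4 s≤)) t≤ ⟩
          4 + (B + 4) + (j * (8 + B) + 4)  ≡⟨ arith B (j * (8 + B)) ⟩
          suc j * (8 + B) + 4              ∎)
    where
    open ≤-Reasoning
    i<n : i < n
    i<n = subst (i <_) e (m<m+n i (s≤s z≤n))
    arith : ∀ b y → 4 + (b + 4) + (y + 4) ≡ (8 + b) + y + 4
    arith = solve-∀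

-- Polynomial bounds on running times

Polynomial : (ℕ → ℕ) → Set
Polynomial f = ∃[ c ] ∃[ d ] (∀ n → f n ≤ c * suc n ^ d)

polynomial-const : ∀ c → Polynomial (λ _ → c)
polynomial-const c = c , 0 , λ _ → ≤-reflexive (sym (*-identityʳ c))

polynomial-id : Polynomial (λ n → n)
polynomial-id = 1 , 1 , λ n → begin
  n              ≤⟨ n≤1+n n ⟩
  suc n          ≡⟨ arith n ⟩
  1 * suc n ^ 1  ∎
  where
  open ≤-Reasoning
  arith : ∀ n → suc n ≡ 1 * (suc n * 1)
  arith = solve-∀

polynomial-+ : ∀ {f g} → Polynomial f → Polynomial g → Polynomial (λ n → f n + g n)
polynomial-+ {f} {g} (c , d , p) (c′ , d′ , p′) = c + c′ , d + d′ , λ n → begin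
  f n + g n                                      ≤⟨ +-mono-≤ (p n) (p′ n) ⟩
  -- The base `suc n` is positive, so both exponents can be raised to `d + d′`.
  c * suc n ^ d + c′ * suc n ^ d′                ≤⟨ +-mono-≤ (*-monoʳ-≤ c (^-monoʳ-≤ (suc n) (m≤m+n d d′)))
                                                             (*-monoʳ-≤ c′ (^-monoʳ-≤ (suc n) (m≤n+m d′ d))) ⟩
  c * suc n ^ (d + d′) + c′ * suc n ^ (d + d′)   ≡⟨ *-distribʳ-+ _ c c′ ⟨
  (c + c′) * suc n ^ (d + d′)                    ∎
  where open ≤-Reasoning

polynomial-* : ∀ {f g} → Polynomial f → Polynomial g → Polynomial (λ n → f n * g n)
polynomial-* {f} {g} (c , d , p) (c′ , d′ , p′) = c * c′ , d + d′ , λ n → begin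
  f n * g n                            ≤⟨ *-mono-≤ (p n) (p′ n) ⟩
  c * suc n ^ d * (c′ * suc n ^ d′)    ≡⟨ [m*n]*[o*p]≡[m*o]*[n*p] c (suc n ^ d) c′ (suc n ^ d′) ⟩
  c * c′ * (suc n ^ d * suc n ^ d′)    ≡⟨ cong (c * c′ *_) (^-distribˡ-+-* (suc n) d d′) ⟨
  c * c′ * suc n ^ (d + d′)            ∎
  where open ≤-Reasoning

timeBound-polynomial : ∀ C → Polynomial (timeBound C)
timeBound-polynomial (x := e)          = polynomial-const _
timeBound-polynomial (a [ d , e ]:= f) = polynomial-const _
timeBound-polynomial (C ▸ D)           =
  polynomial-+ (timeBound-polynomial C) (timeBound-polynomial D)
timeBound-polynomial (unless e C)      =
  polynomial-+ (polynomial-const (suc (cost e)))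
    (polynomial-+ (polynomial-const 1) (timeBound-polynomial C))
timeBound-polynomial (for x C)         =
  polynomial-+ (polynomial-const 2)
    (polynomial-+ (polynomial-* polynomial-id (polynomial-+ (polynomial-const 8) (timeBound-polynomial C)))
                  (polynomial-const 4))

-- Sums and counting

sum : ℕ → (ℕ → ℕ) → ℕ
sum zero    f = 0
sum (suc n) f = f n + sum n f

count : ℕ → (ℕ → Bool) → ℕ
count n p = sum n λ i → bit (p i)

sum-cong : ∀ n {f g} → (∀ {i} → i < n → f i ≡ g i) → sum n f ≡ sum n g
sum-cong zero    eq = refl
sum-cong (suc n) eq = cong₂ _+_ (eq ≤-refl) (sum-cong n λ i<n → eq (m<n⇒m<1+n i<n))

sum-mono : ∀ n {f g} → (∀ {i} → i < n → f i ≤ g i) → sum n f ≤ sum n g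
sum-mono zero    le = z≤n
sum-mono (suc n) le = +-mono-≤ (le ≤-refl) (sum-mono n λ i<n → le (m<n⇒m<1+n i<n))

sum-+ : ∀ n f g → sum n (λ i → f i + g i) ≡ sum n f + sum n g
sum-+ zero    f g = refl
sum-+ (suc n) f g rewrite sum-+ n f g = arith (f n) (g n) (sum n f) (sum n g)
  where
  arith : ∀ a b c d → a + b + (c + d) ≡ a + c + (b + d)
  arith = solve-∀

sum-0 : ∀ n → sum n (λ _ → 0) ≡ 0
sum-0 zero    = refl
sum-0 (suc n) = sum-0 n

sum-swap : ∀ n m (f : ℕ → ℕ → ℕ) → sum n (λ i → sum m (f i)) ≡ sum m (λ j → sum n (λ i → f i j))
sum-swap zero    m f = sym (sum-0 m)
sum-swap (suc n) m f rewrite sum-swap n m f = sym (sum-+ m (f n) _)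

sum-front : ∀ n f → sum (suc n) f ≡ f 0 + sum n (λ i → f (suc i))
sum-front zero    f = refl
sum-front (suc n) f rewrite sum-front n f = arith (f (suc n)) (f 0) _
  where
  arith : ∀ a b c → a + (b + c) ≡ b + (a + c)
  arith = solve-∀

term≤sum : ∀ n f {i} → i < n → f i ≤ sum n f
term≤sum (suc n) f {i} i<1+n with i ≟ n
... | yes refl = m≤m+n _ _
... | no i≢n   = ≤-trans (term≤sum n f (≤∧≢⇒< (s≤s⁻¹ i<1+n) i≢n)) (m≤n+m _ _)

sum≡0 : ∀ n {f} → (∀ {i} → i < n → f i ≡ 0) → sum n f ≡ 0
sum≡0 n eq = trans (sum-cong n eq) (sum-0 n)

sum-tight : ∀ n {f g} → (∀ {i} → i < n → f i ≤ g i) → sum n g ≤ sum n f →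
            ∀ {i} → i < n → g i ≤ f i
sum-tight (suc n) {f} {g} le tot {i} i<1+n with i ≟ n
... | yes refl = +-cancelʳ-≤ (sum n g) _ _ (≤-trans tot (+-monoʳ-≤ (f n) (sum-mono n λ j<n → le (m<n⇒m<1+n j<n))))
... | no i≢n   = sum-tight n (λ j<n → le (m<n⇒m<1+n j<n))
                   (+-cancelˡ-≤ (g n) _ _ (≤-trans tot (+-monoˡ-≤ _ (le ≤-refl))))
                   (≤∧≢⇒< (s≤s⁻¹ i<1+n) i≢n)

bit-mono : ∀ {a b} → (T a → T b) → bit a ≤ bit b
bit-mono {false}         imp = z≤n
bit-mono {true}  {true}  imp = ≤-refl
bit-mono {true}  {false} imp = ⊥-elim (imp _)

bit-reflects : ∀ {a b} → bit a ≤ bit b → T a → T b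
bit-reflects {true} {true} _ _ = _

bit-cong : ∀ {a b} → (T a → T b) → (T b → T a) → bit a ≡ bit b
bit-cong p q = ≤-antisym (bit-mono p) (bit-mono q)

count-mono : ∀ n {p q} → (∀ {i} → i < n → T (p i) → T (q i)) → count n p ≤ count n q
count-mono n imp = sum-mono n λ i<n → bit-mono (imp i<n)

count-cong : ∀ n {p q} → (∀ {i} → i < n → T (p i) → T (q i)) →
             (∀ {i} → i < n → T (q i) → T (p i)) → count n p ≡ count n q
count-cong n p q = sum-cong n λ i<n → bit-cong (p i<n) (q i<n)

-- A subset of a finite set that is at least as large is the whole set. In this way closed
-- neighbourhoods of full degree are identified with classes.
count-tight : ∀ n {p q} → (∀ {i} → i < n → T (p i) → T (q i)) → count n q ≤ count n p →
              ∀ {i} → i < n → T (q i) → T (p i)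
count-tight n imp le i<n = bit-reflects (sum-tight n (λ j<n → bit-mono (imp j<n)) le i<n)

count>0⇒∃ : ∀ n p → 0 < count n p → ∃[ i ] i < n × T (p i)
count>0⇒∃ (suc n) p pos with p n in eq
... | true  = n , ≤-refl , subst T (sym eq) _
... | false = let (i , i<n , pi) = count>0⇒∃ n p pos in i , m<n⇒m<1+n i<n , pi

∧-intro : ∀ {a b} → T a → T b → T (a ∧ b)
∧-intro {true} _ q = q

∧-fst : ∀ {a b} → T (a ∧ b) → T a
∧-fst {true} _ = _

∧-snd : ∀ {a b} → T (a ∧ b) → T b
∧-snd {true} q = q

not-intro : ∀ {a} → ¬ T a → T (not a)
not-intro {false} _ = _
not-intro {true}  f = f _

not-elim : ∀ {a} → T (not a) → ¬ T a
not-elim {false} _ ()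

-- Packings

Adjacency : Set
Adjacency = ℕ → ℕ → Bool

degree : ℕ → Adjacency → ℕ → ℕ
degree n β v = count n (β v)

everything : ℕ → Bool
everything _ = true

-- The subgraph on the vertices v < n in K is contained in a disjoint union of
-- cliques of size s on the same vertices.  Adjacency here is reflexive, so the
-- degree of a vertex is the size of its closed neighbourhood.
record Packing (n : ℕ) (K : ℕ → Bool) (β : Adjacency) (s : ℕ) : Set where
  field
    colour    : ℕ → ℕ
    respects  : ∀ {u v} → u < n → v < n → T (K u) → T (K v) → T (β u v) → colour u ≡ colour v
    classSize : ∀ {v} → v < n → T (K v) → count n (λ u → K u ∧ (colour u ≡ᵇ colour v)) ≡ s

deficit : ℕ → Adjacency → ℕ → ℕ
deficit n β s = sum n λ v → s ∸ degree n β v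

-- For the symmetric adjacencies in use, `K` is a union of components.
Closed : ℕ → Adjacency → (ℕ → Bool) → Set
Closed n β K = ∀ {u v} → u < n → v < n → T (β u v) → T (K u) → T (K v)

-- No clique is required: a component `N[v]` of `s` vertices is a class of every packing of size
-- `s`, since the class of `v` contains it and is no larger.
record Good (n : ℕ) (β : Adjacency) (s v : ℕ) : Set where
  field
    degree≡ : degree n β v ≡ s
    closed  : Closed n β (β v)

≡ᵇ-intro : ∀ {a b} → a ≡ b → T (a ≡ᵇ b)
≡ᵇ-intro {a} {b} = ≡⇒≡ᵇ a b

≡ᵇ-elim : ∀ {a b} → T (a ≡ᵇ b) → a ≡ b
≡ᵇ-elim {a} {b} = ≡ᵇ⇒≡ a b

module _ {n : ℕ} {β : Adjacency} {s : ℕ} (P : Packing n everything β s) where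

  open Packing
  open Good

  private
    class : ∀ {v} → v < n → ∀ {u} → u < n → T (β v u) → T (colour P u ≡ᵇ colour P v)
    class v<n u<n vu = ≡ᵇ-intro (sym (respects P v<n u<n _ _ vu))

  packing⇒degree≤ : ∀ {v} → v < n → degree n β v ≤ s
  packing⇒degree≤ v<n = subst (_ ≤_) (classSize P v<n _) (count-mono n (class v<n))

  -- A vertex of full degree has its whole class as closed neighbourhood.
  packing⇒good : ∀ {v} → v < n → degree n β v ≡ s → Good n β s v
  packing⇒good v<n d≡s .degree≡ = d≡s
  packing⇒good v<n d≡s .closed u<n w<n uw vu =
    count-tight n (class v<n) (≤-reflexive (trans (classSize P v<n _) (sym d≡s))) w<n
      (≡ᵇ-intro (trans (sym (respects P u<n w<n _ _ uw)) (sym (respects P v<n u<n _ _ vu))))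

-- If all degrees were below `s`, each of the `n` vertices would contribute at least 1 to the
-- deficit.
deficit-attained : ∀ n β s → deficit n β s < n → (∀ {v} → v < n → degree n β v ≤ s) →
  ∃[ v ] v < n × degree n β v ≡ s
deficit-attained n β s small le = go n ≤-refl small
  where
  go : ∀ m → m ≤ n → sum m (λ v → s ∸ degree n β v) < m → ∃[ v ] v < n × degree n β v ≡ s
  go (suc m) m<n lt with s ∸ degree n β m in eq
  ... | zero  = m , m<n , ≤-antisym (le m<n) (m∸n≡0⇒m≤n eq)
  ... | suc d = go m (<⇒≤ m<n) (≤-<-trans (m≤n+m _ d) (s≤s⁻¹ lt))

-- Both sizes are attained as degrees and bound all degrees.
size-unique : ∀ {n β s s′} →
  deficit n β s < n → (∀ {v} → v < n → degree n β v ≤ s) →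
  deficit n β s′ < n → (∀ {v} → v < n → degree n β v ≤ s′) → s ≡ s′
size-unique {n} {β} {s} {s′} d le d′ le′ = ≤-antisym (half s s′ d le le′) (half s′ s d′ le′ le)
  where
  half : ∀ s s′ → deficit n β s < n → (∀ {v} → v < n → degree n β v ≤ s) →
         (∀ {v} → v < n → degree n β v ≤ s′) → s ≤ s′
  half s s′ d le le′ = let (v , v<n , eq) = deficit-attained n β s d le in
    subst (_≤ s′) eq (le′ v<n)

module Deletion {n : ℕ} {β : Adjacency} {s : ℕ}
  (β-sym : ∀ {u v} → T (β u v) → T (β v u)) (β-refl : ∀ v → T (β v v))
  {K K′ : ℕ → Bool} (K-closed : Closed n β K)
  {v : ℕ} (v<n : v < n) (v∈K : T (K v)) (v-good : Good n β s v)
  (K′≡ : ∀ {u} → u < n → K′ u ≡ K u ∧ not (β v u)) where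

  open Packing
  open Good

  private
    K′⇒K : ∀ {u} → u < n → T (K′ u) → T (K u)
    K′⇒K u<n k = ∧-fst (subst T (K′≡ u<n) k)

    K′⇒¬β : ∀ {u} → u < n → T (K′ u) → ¬ T (β v u)
    K′⇒¬β {u} u<n k = not-elim (∧-snd {K u} (subst T (K′≡ u<n) k))

    ⇒K′ : ∀ {u} → u < n → T (K u) → ¬ T (β v u) → T (K′ u)
    ⇒K′ u<n k b = subst T (sym (K′≡ u<n)) (∧-intro k (not-intro b))

    β⇒K : ∀ {u} → u < n → T (β v u) → T (K u)
    β⇒K u<n vu = K-closed v<n u<n vu v∈K

  deleted : ¬ T (K′ v)
  deleted k = K′⇒¬β v<n k (β-refl v)

  subset : ∀ {u} → u < n → T (K′ u) → T (K u)
  subset = K′⇒K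

  -- An edge from `K′` into `N[v]`, read backwards, would leave the closed set `N[v]`.
  closed′ : Closed n β K′
  closed′ u<n w<n uw k = ⇒K′ w<n (K-closed u<n w<n uw (K′⇒K u<n k))
    (λ vw → K′⇒¬β u<n k (closed v-good w<n u<n (β-sym uw) vw))

  count≡ : count n K ≡ s + count n K′
  count≡ = begin
    count n K                               ≡⟨ sum-cong n split ⟩
    sum n (λ u → bit (β v u) + bit (K′ u))  ≡⟨ sum-+ n (λ u → bit (β v u)) (λ u → bit (K′ u)) ⟩
    degree n β v + count n K′               ≡⟨ cong (_+ count n K′) (degree≡ v-good) ⟩
    s + count n K′                          ∎
    where
    open ≡-Reasoning
    split : ∀ {u} → u < n → bit (K u) ≡ bit (β v u) + bit (K′ u)
    split {u} u<n with β v u in b | K u in k | K′≡ u<n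
    ... | true  | true  | eq rewrite eq = refl
    ... | true  | false | eq = ⊥-elim (subst T k (β⇒K u<n (subst T (sym b) _)))
    ... | false | true  | eq rewrite eq = refl
    ... | false | false | eq rewrite eq = refl

  shrink : Packing n K β s → Packing n K′ β s
  shrink P .colour = colour P
  shrink P .respects u<n w<n ku kw = respects P u<n w<n (K′⇒K u<n ku) (K′⇒K w<n kw)
  shrink P .classSize {x} x<n kx = trans
    (count-cong n
      (λ {u} u<n h → ∧-intro (K′⇒K u<n (∧-fst h)) (∧-snd {K′ u} h))
      (λ {u} u<n h → ∧-intro (⇒K′ u<n (∧-fst h) (apart u<n (∧-fst h) (≡ᵇ-elim (∧-snd {K u} h)))) (∧-snd {K u} h)))
    (classSize P x<n (K′⇒K x<n kx))
    where
    -- The class of v is its closed neighbourhood, so no class of K′ meets it.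
    apart : ∀ {u} → u < n → T (K u) → colour P u ≡ colour P x → ¬ T (β v u)
    apart {u} u<n ku ux vu = K′⇒¬β x<n kx
      (count-tight n
        (λ w<n vw → ∧-intro (β⇒K w<n vw) (≡ᵇ-intro (sym (respects P v<n w<n v∈K (β⇒K w<n vw) vw))))
        (≤-reflexive (trans (classSize P v<n v∈K) (sym (degree≡ v-good)))) x<n
        (∧-intro (K′⇒K x<n kx) (≡ᵇ-intro (trans (sym ux) (sym (respects P v<n u<n v∈K ku vu))))))

  -- The deleted neighbourhood has `s` vertices and no edge leaves it, so it becomes a class of its
  -- own: it gets colour 0, and the old colours move up by one to stay clear of it.
  extend : Packing n K′ β s → Packing n K β s
  extend P = record { colour = c ; respects = extends ; classSize = sizes }
    where
    c : ℕ → ℕ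
    c u = if β v u then 0 else suc (colour P u)

    c-in : ∀ {u} → T (β v u) → c u ≡ 0
    c-in {u} b with true ← β v u = refl

    c-out : ∀ {u} → ¬ T (β v u) → c u ≡ suc (colour P u)
    c-out {u} b with β v u
    ... | true  = ⊥-elim (b _)
    ... | false = refl

    c≡0⇒in : ∀ {u} → c u ≡ 0 → T (β v u)
    c≡0⇒in {u} eq with true ← β v u = _

    decide : ∀ b → T b ⊎ ¬ T b
    decide true  = inj₁ _
    decide false = inj₂ λ ()

    extends : ∀ {u w} → u < n → w < n → T (K u) → T (K w) → T (β u w) → c u ≡ c w
    extends {u} {w} u<n w<n ku kw uw with decide (β v u)
    ... | inj₁ vu = trans (c-in vu) (sym (c-in (closed v-good u<n w<n uw vu)))
    ... | inj₂ ¬vu = let ¬vw = λ vw → ¬vu (closed v-good w<n u<n (β-sym uw) vw) in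
      trans (c-out ¬vu) (trans (cong suc (respects P u<n w<n (⇒K′ u<n ku ¬vu) (⇒K′ w<n kw ¬vw) uw))
                               (sym (c-out ¬vw)))

    sizes : ∀ {x} → x < n → T (K x) → count n (λ u → K u ∧ (c u ≡ᵇ c x)) ≡ s
    sizes {x} x<n kx with decide (β v x)
    ... | inj₁ vx = trans
      (count-cong n (λ {u} u<n h → c≡0⇒in (trans (≡ᵇ-elim (∧-snd {K u} h)) (c-in vx)))
                    (λ u<n vu → ∧-intro (β⇒K u<n vu) (≡ᵇ-intro (trans (c-in vu) (sym (c-in vx))))))
      (degree≡ v-good)
    ... | inj₂ ¬vx = trans (count-cong n there back) (classSize P x<n (⇒K′ x<n kx ¬vx))
      where
      there : ∀ {u} → u < n → T (K u ∧ (c u ≡ᵇ c x)) → T (K′ u ∧ (colour P u ≡ᵇ colour P x))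
      there {u} u<n h = ∧-intro (⇒K′ u<n (∧-fst h) ¬vu)
        (≡ᵇ-intro (suc-injective (trans (sym (c-out ¬vu)) (trans eq (c-out ¬vx)))))
        where
        eq  = ≡ᵇ-elim {c u} (∧-snd {K u} h)
        ¬vu : ¬ T (β v u)
        ¬vu vu = ¬vx (c≡0⇒in (trans (sym eq) (c-in vu)))
      back : ∀ {u} → u < n → T (K′ u ∧ (colour P u ≡ᵇ colour P x)) → T (K u ∧ (c u ≡ᵇ c x))
      back {u} u<n h = ∧-intro (K′⇒K u<n (∧-fst h))
        (≡ᵇ-intro (trans (c-out (K′⇒¬β u<n (∧-fst h)))
          (trans (cong suc (≡ᵇ-elim (∧-snd {K′ u} h))) (sym (c-out ¬vx)))))

-- Ranks and the relabelling of an induced subgraph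

rank : (ℕ → Bool) → ℕ → ℕ
rank K v = count v K

rank-mono-≤ : ∀ K {u v} → u ≤ v → rank K u ≤ rank K v
rank-mono-≤ K {u} {zero}  z≤n = z≤n
rank-mono-≤ K {u} {suc v} u≤1+v with u ≟ suc v
... | yes refl = ≤-refl
... | no  u≢   = ≤-trans (rank-mono-≤ K (s≤s⁻¹ (≤∧≢⇒< u≤1+v u≢))) (m≤n+m _ _)

rank-step : ∀ K {v} → T (K v) → rank K (suc v) ≡ suc (rank K v)
rank-step K {v} k with true ← K v = refl

rank-mono-< : ∀ K {u v} → T (K u) → u < v → rank K u < rank K v
rank-mono-< K {u} {v} ku u<v = subst (_≤ rank K v) (rank-step K ku) (rank-mono-≤ K u<v)

rank-surjective : ∀ K n {p} → p < rank K n → ∃[ v ] v < n × T (K v) × rank K v ≡ p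
rank-surjective K (suc n) {p} p< with K n in k
... | false = let (v , v<n , r) = rank-surjective K n p< in v , m<n⇒m<1+n v<n , r
... | true with p ≟ rank K n
...   | yes refl = n , ≤-refl , subst T (sym k) _ , refl
...   | no p≢    = let (v , v<n , r) = rank-surjective K n (≤∧≢⇒< (s≤s⁻¹ p<) p≢) in
                   v , m<n⇒m<1+n v<n , r

sum-rank : ∀ K n f → sum (rank K n) f ≡ sum n (λ v → if K v then f (rank K v) else 0)
sum-rank K zero    f = refl
sum-rank K (suc n) f with K n
... | true  = cong (f (rank K n) +_) (sum-rank K n f)
... | false = sum-rank K n f

-- `pos` is kept abstract because it will be the content of an array filled by the program, known
-- only through its values at ranks.
module Relabelling {n : ℕ} {β : Adjacency} {s : ℕ} (K : ℕ → Bool) (K-closed : Closed n β K) (pos : ℕ → ℕ)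
  (pos-rank : ∀ {v} → v < n → T (K v) → pos (rank K v) ≡ v) where

  open Packing

  m : ℕ
  m = rank K n

  β′ : Adjacency
  β′ p q = β (pos p) (pos q)

  unrank : ∀ {p} → p < m → pos p < n × T (K (pos p)) × rank K (pos p) ≡ p
  unrank p<m with v , v<n , kv , refl ← rank-surjective K n p<m
    rewrite pos-rank v<n kv = v<n , kv , refl

  rank< : ∀ {v} → v < n → T (K v) → rank K v < m
  rank< v<n kv = rank-mono-< K kv v<n

  pos-injective : ∀ {p q} → p < m → q < m → pos p ≡ pos q → p ≡ q
  pos-injective p<m q<m eq with _ , _ , rp ← unrank p<m | _ , _ , rq ← unrank q<m =
    trans (sym rp) (trans (cong (rank K) eq) rq)

  count-pos : ∀ (f g : ℕ → Bool) → (∀ {v} → v < n → T (K v) → f (rank K v) ≡ g v) →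
    count m f ≡ count n (λ v → K v ∧ g v)
  count-pos f g eq = trans (sum-rank K n _) (sum-cong n same)
    where
    same : ∀ {v} → v < n → (if K v then bit (f (rank K v)) else 0) ≡ bit (K v ∧ g v)
    same {v} v<n with K v in k
    ... | true  = cong bit (eq v<n (subst T (sym k) _))
    ... | false = refl

  -- No edge leaves `K`, so passing to the induced subgraph loses no neighbour.
  degree-pos : ∀ {v} → v < n → T (K v) → degree m β′ (rank K v) ≡ degree n β v
  degree-pos {v} v<n kv = trans
    (count-pos _ (β v) λ u<n ku → cong₂ β (pos-rank v<n kv) (pos-rank u<n ku))
    (count-cong n (λ {u} _ h → ∧-snd {K u} h) (λ u<n vu → ∧-intro (K-closed v<n u<n vu kv) vu))

  degree′≤ : (∀ {v} → v < n → degree n β v ≤ s) → ∀ {p} → p < m → degree m β′ p ≤ s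
  degree′≤ le p<m with v , v<n , kv , refl ← rank-surjective K n p<m =
    subst (_≤ s) (sym (degree-pos v<n kv)) (le v<n)

  -- Survivors keep their degrees. Equality can fail, as deleted vertices other than the good one
  -- may have had a positive deficit.
  deficit′≤ : deficit m β′ s ≤ deficit n β s
  deficit′≤ = subst (_≤ _) (sym (sum-rank K n _)) (sum-mono n bound)
    where
    bound : ∀ {v} → v < n → (if K v then s ∸ degree m β′ (rank K v) else 0) ≤ s ∸ degree n β v
    bound {v} v<n with K v in k
    ... | true  = ≤-reflexive (cong (s ∸_) (degree-pos v<n (subst T (sym k) _)))
    ... | false = z≤n

  relabel : Packing n K β s → Packing m everything β′ s
  relabel P .colour p = colour P (pos p)
  relabel P .respects p<m q<m _ _ with p<n , kp , _ ← unrank p<m | q<n , kq , _ ← unrank q<m =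
    respects P p<n q<n kp kq
  relabel P .classSize {p} p<m _ with p<n , kp , _ ← unrank p<m = trans
    (count-pos _ (λ u → colour P u ≡ᵇ colour P (pos p))
      λ v<n kv → cong (λ z → colour P z ≡ᵇ colour P (pos p)) (pos-rank v<n kv))
    (classSize P p<n kp)

  unrelabel : Packing m everything β′ s → Packing n K β s
  unrelabel P .colour v = colour P (rank K v)
  unrelabel P .respects u<n v<n ku kv uv = respects P (rank< u<n ku) (rank< v<n kv) _ _
    (subst₂ (λ x y → T (β x y)) (sym (pos-rank u<n ku)) (sym (pos-rank v<n kv)) uv)
  unrelabel P .classSize v<n kv = trans
    (sym (count-pos _ _ λ _ _ → refl)) (classSize P (rank< v<n kv) _)

-- Completion sets and packings

T-ext : ∀ {a b} → (T a → T b) → (T b → T a) → a ≡ b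
T-ext {false} {false} _ _ = refl
T-ext {false} {true}  _ g = ⊥-elim (g _)
T-ext {true}  {false} f _ = ⊥-elim (f _)
T-ext {true}  {true}  _ _ = refl

T⇒≡ : ∀ {a} → T a → a ≡ true
T⇒≡ {true} _ = refl

≡⇒T : ∀ {a} → a ≡ true → T a
≡⇒T refl = _

∨-elim : ∀ {a b} → T (a ∨ b) → T a ⊎ T b
∨-elim {true}  t = inj₁ _
∨-elim {false} t = inj₂ t

∨-left : ∀ {a b} → T a → T (a ∨ b)
∨-left {true} _ = _

∨-right : ∀ {a b} → T b → T (a ∨ b)
∨-right {true}  _ = _
∨-right {false} t = t

below : ∀ {n} (P : ℕ → Set) → (∀ (i : Fin n) → P (toℕ i)) → ∀ {v} → v < n → P v
below P f v<n = subst P (toℕ-fromℕ< v<n) (f (fromℕ< v<n))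

below₂ : ∀ {n} (P : ℕ → ℕ → Set) → (∀ (i j : Fin n) → P (toℕ i) (toℕ j)) →
         ∀ {u v} → u < n → v < n → P u v
below₂ P f u<n v<n = below (λ u → P u _) (λ i → below (P (toℕ i)) (f i) v<n) u<n

∣tabulate∣ : ∀ n (f : Fin n → Bool) (g : ℕ → Bool) → (∀ i → f i ≡ g (toℕ i)) →
  ∣ Vec.tabulate f ∣ ≡ count n g
∣tabulate∣ zero    f g eq = refl
∣tabulate∣ (suc n) f g eq = trans (head (f Fin.zero) (eq Fin.zero)) (sym (sum-front n (λ i → bit (g i))))
  where
  head : ∀ b → b ≡ g 0 → ∣ b Vec.∷ Vec.tabulate (f ∘ Fin.suc) ∣ ≡ bit (g 0) + count n (g ∘ suc)
  head true  e rewrite sym e = cong suc (∣tabulate∣ n (f ∘ Fin.suc) (g ∘ suc) (eq ∘ Fin.suc))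
  head false e rewrite sym e = ∣tabulate∣ n (f ∘ Fin.suc) (g ∘ suc) (eq ∘ Fin.suc)

module _ {A : Set} {P : A → Set} (P? : Decidable P) where

  length-filter-∷ : ∀ x xs → length (filter P? (x ∷ xs)) ≡ bit (does (P? x)) + length (filter P? xs)
  length-filter-∷ x xs with does (P? x)
  ... | true  = refl
  ... | false = refl

  length-filter-tabulate : ∀ n (f : Fin n → A) (g : ℕ → ℕ) →
    (∀ i → bit (does (P? (f i))) ≡ g (toℕ i)) → length (filter P? (List.tabulate f)) ≡ sum n g
  length-filter-tabulate zero    f g eq = refl
  length-filter-tabulate (suc n) f g eq = trans (length-filter-∷ (f Fin.zero) _)
    (trans (cong₂ _+_ (eq Fin.zero) (length-filter-tabulate n (f ∘ Fin.suc) (g ∘ suc) (eq ∘ Fin.suc)))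
           (sym (sum-front n g)))

length-filter-product : ∀ {A B : Set} {P : A × B → Set} (P? : Decidable P)
  n m (f : Fin n → A) (h : Fin m → B) (g : ℕ → ℕ → ℕ) →
  (∀ i j → bit (does (P? (f i , h j))) ≡ g (toℕ i) (toℕ j)) →
  length (filter P? (cartesianProduct (List.tabulate f) (List.tabulate h))) ≡ sum n (λ i → sum m (g i))
length-filter-product P? zero    m f h g eq = refl
length-filter-product P? (suc n) m f h g eq = begin
  length (filter P? (row ++ rest))                  ≡⟨ cong length (filter-++ P? row rest) ⟩
  length (filter P? row ++ filter P? rest)          ≡⟨ length-++ (filter P? row) ⟩
  length (filter P? row) + length (filter P? rest)  ≡⟨ cong₂ _+_ row≡ rest≡ ⟩
  sum m (g 0) + sum n (λ i → sum m (g (suc i)))     ≡⟨ sum-front n (λ i → sum m (g i)) ⟨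
  sum (suc n) (λ i → sum m (g i))                   ∎
  where
  open ≡-Reasoning
  row  = List.map (f Fin.zero ,_) (List.tabulate h)
  rest = cartesianProduct (List.tabulate (f ∘ Fin.suc)) (List.tabulate h)
  row≡ : length (filter P? row) ≡ sum m (g 0)
  row≡ = trans (cong (length ∘ filter P?) (map-tabulate h (f Fin.zero ,_)))
               (length-filter-tabulate P? m _ (g 0) (eq Fin.zero))
  rest≡ : length (filter P? rest) ≡ sum n (λ i → sum m (g (suc i)))
  rest≡ = length-filter-product P? n m (f ∘ Fin.suc) h (g ∘ suc) (eq ∘ Fin.suc)

matrix-toℕ : ∀ {n} (G : Graph n) u v → matrix G (toℕ u) (toℕ v) ≡ bit (adj G u v)
matrix-toℕ {n} G u v with toℕ u <? n | toℕ v <? n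
... | yes p | yes q = cong₂ (λ x y → bit (adj G x y)) (fromℕ<-toℕ u p) (fromℕ<-toℕ v q)
... | no ¬p | _     = contradiction (toℕ<n u) ¬p
... | yes _ | no ¬q = contradiction (toℕ<n v) ¬q

matrix-sym : ∀ {n} (G : Graph n) u v → matrix G u v ≡ matrix G v u
matrix-sym {n} G u v with u <? n | v <? n
... | yes p | yes q = cong bit (adj-sym G _ _)
... | yes _ | no _  = refl
... | no _  | yes _ = refl
... | no _  | no _  = refl

matrix-irrefl : ∀ {n} (G : Graph n) v → matrix G v v ≡ 0
matrix-irrefl {n} G v with v <? n
... | yes p = cong bit (adj-irrefl G _)
... | no _  = refl

matrix-bit : ∀ {n} (G : Graph n) u v → matrix G u v ≡ bit (0 <ᵇ matrix G u v)
matrix-bit {n} G u v with u <? n | v <? n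
... | yes p | yes q with adj G (fromℕ< p) (fromℕ< q)
...   | true  = refl
...   | false = refl
matrix-bit {n} G u v | yes _ | no _  = refl
matrix-bit {n} G u v | no _  | yes _ = refl
matrix-bit {n} G u v | no _  | no _  = refl

-- The matrix is its strictly upper triangle, which lists every edge once, plus the transpose of
-- that triangle; the diagonal is zero.
double-edges : ∀ {n} (F : EdgeSet n) → sum n (λ u → sum n (matrix F u)) ≡ ∣ F ∣ₑ + ∣ F ∣ₑ
double-edges {n} F = begin
  sum n (λ u → sum n (matrix F u))                               ≡⟨ sum-cong n (λ {u} _ → splitRow u) ⟩
  sum n (λ u → sum n (e u) + sum n (λ v → e v u))                ≡⟨ sum-+ n (λ u → sum n (e u)) _ ⟩
  sum n (λ u → sum n (e u)) + sum n (λ u → sum n (λ v → e v u))  ≡⟨ cong (sum n (λ u → sum n (e u)) +_) (sum-swap n n e) ⟨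
  sum n (λ u → sum n (e u)) + sum n (λ u → sum n (e u))          ≡⟨ cong₂ _+_ edges≡ edges≡ ⟨
  ∣ F ∣ₑ + ∣ F ∣ₑ                                                ∎
  where
  open ≡-Reasoning
  e : ℕ → ℕ → ℕ
  e u v = if does (u <? v) then matrix F u v else 0

  e-< : ∀ {u v} → u < v → e u v ≡ matrix F u v
  e-< {u} {v} u<v = cong (λ b → if b then matrix F u v else 0) (dec-true (u <? v) u<v)

  e-≮ : ∀ {u v} → ¬ u < v → e u v ≡ 0
  e-≮ {u} {v} u≮v = cong (λ b → if b then matrix F u v else 0) (dec-false (u <? v) u≮v)

  split : ∀ u v → matrix F u v ≡ e u v + e v u
  split u v with <-cmp u v
  ... | tri< u<v _ v≮u rewrite e-< u<v | e-≮ v≮u = sym (+-identityʳ _)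
  ... | tri> u≮v _ v<u rewrite e-≮ u≮v | e-< v<u = matrix-sym F u v
  ... | tri≈ u≮u refl _ rewrite e-≮ u≮u = matrix-irrefl F u

  splitRow : ∀ u → sum n (matrix F u) ≡ sum n (e u) + sum n (λ v → e v u)
  splitRow u = trans (sum-cong n (λ {v} _ → split u v)) (sum-+ n (e u) (λ v → e v u))

  edges≡ : ∣ F ∣ₑ ≡ sum n (λ u → sum n (e u))
  edges≡ = length-filter-product (λ (u , v) → (u <?ᶠ v) ×-dec T? (adj F u v)) n n id id e bits
    where
    bits : ∀ u v → bit (does ((u <?ᶠ v) ×-dec T? (adj F u v))) ≡ e (toℕ u) (toℕ v)
    bits u v rewrite matrix-toℕ F u v with does (toℕ u <? toℕ v)
    ... | true  = refl
    ... | false = refl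

neighbourhood : ∀ {n} → Graph n → Adjacency
neighbourhood G u v = (u ≡ᵇ v) ∨ (0 <ᵇ matrix G u v)

neighbourhood-refl : ∀ {n} (G : Graph n) v → T (neighbourhood G v v)
neighbourhood-refl G v = ∨-left (≡ᵇ-intro {v} refl)

neighbourhood-sym : ∀ {n} (G : Graph n) {u v} → T (neighbourhood G u v) → T (neighbourhood G v u)
neighbourhood-sym G {u} {v} uv with ∨-elim {u ≡ᵇ v} uv
... | inj₁ u≡v = ∨-left (≡ᵇ-intro {v} (sym (≡ᵇ-elim {u} u≡v)))
... | inj₂ adj = ∨-right {v ≡ᵇ u} (subst (λ x → T (0 <ᵇ x)) (matrix-sym G u v) adj)

module _ {n : ℕ} (G : Graph n) {u v : Fin n} where

  adj⇒neighbourhood : T (adj G u v) → T (neighbourhood G (toℕ u) (toℕ v))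
  adj⇒neighbourhood uv = ∨-right {toℕ u ≡ᵇ toℕ v}
    (subst (λ x → T (0 <ᵇ x)) (trans (cong bit (sym (T⇒≡ uv))) (sym (matrix-toℕ G u v))) _)

  neighbourhood⇒≡⊎adj : T (neighbourhood G (toℕ u) (toℕ v)) → u ≡ v ⊎ T (adj G u v)
  neighbourhood⇒≡⊎adj uv with ∨-elim {toℕ u ≡ᵇ toℕ v} uv
  ... | inj₁ u≡v = inj₁ (toℕ-injective (≡ᵇ-elim {toℕ u} u≡v))
  ... | inj₂ pos rewrite matrix-toℕ G u v with adj G u v
  ...   | true = inj₂ _

-- The form of UCEA used from here on, with the clique size made explicit. The bound is `k + k`
-- because each added edge lowers the deficit at both of its ends.
Fits : ∀ {n} → Graph n → ℕ → ℕ → Set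
Fits {n} G k s = Packing n everything (neighbourhood G) s × deficit n (neighbourhood G) s ≤ k + k

extendByZero : ∀ {n} → (Fin n → ℕ) → ℕ → ℕ
extendByZero {n} f v with v <? n
... | yes p = f (fromℕ< p)
... | no _  = 0

extendByZero-toℕ : ∀ {n} (f : Fin n → ℕ) i → extendByZero f (toℕ i) ≡ f i
extendByZero-toℕ {n} f i with toℕ i <? n
... | yes p = cong f (fromℕ<-toℕ i p)
... | no ¬p = contradiction (toℕ<n i) ¬p

-- The edges of F at v must fill up the class of v, so F has at least half the
-- deficit many edges.
UCEA⇒Fits : ∀ I → UCEA I → ∃[ s ] Fits (graph I) (param I) s
UCEA⇒Fits I (F , F≤k , s , m , c , cluster , size≡) = s , packing , (begin
  deficit n β s                        ≤⟨ sum-mono n missing ⟩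
  sum n (λ v → sum n (matrix F v))     ≡⟨ double-edges F ⟩
  ∣ F ∣ₑ + ∣ F ∣ₑ                      ≤⟨ +-mono-≤ F≤k F≤k ⟩
  param I + param I                    ∎)
  where
  open ≤-Reasoning
  G = graph I
  n = order I
  β = neighbourhood G

  c′ : ℕ → ℕ
  c′ = extendByZero (toℕ ∘ c)

  c′-toℕ : ∀ i → c′ (toℕ i) ≡ toℕ (c i)
  c′-toℕ = extendByZero-toℕ (toℕ ∘ c)

  β⇒same : ∀ u v → T (β (toℕ u) (toℕ v)) → c u ≡ c v
  β⇒same u v uv with neighbourhood⇒≡⊎adj G uv
  ... | inj₁ u≡v = cong c u≡v
  ... | inj₂ adj = proj₂ (Equivalence.to (cluster u v) (T⇒≡ (∨-left adj)))

  class≡ : ∀ v → count n (λ u → c′ u ≡ᵇ c′ (toℕ v)) ≡ s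
  class≡ v = trans (sym (∣tabulate∣ n _ _ same)) (size≡ v)
    where
    same : ∀ u → does (c u ≟ᶠ c v) ≡ (c′ (toℕ u) ≡ᵇ c′ (toℕ v))
    same u rewrite c′-toℕ u | c′-toℕ v with c u ≟ᶠ c v
    ... | yes eq = sym (T⇒≡ (≡ᵇ-intro (cong toℕ eq)))
    ... | no neq = T-ext (λ ()) (λ eq → neq (toℕ-injective (≡ᵇ-elim eq)))

  packing : Packing n everything β s
  packing = record
    { colour    = c′
    ; respects  = λ u<n v<n _ _ → below₂ (λ u v → T (β u v) → c′ u ≡ c′ v)
        (λ u v uv → trans (c′-toℕ u) (trans (cong toℕ (β⇒same u v uv)) (sym (c′-toℕ v)))) u<n v<n
    ; classSize = λ v<n _ → below (λ v → count n (λ u → c′ u ≡ᵇ c′ v) ≡ s) class≡ v<n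
    }

  covered : ∀ {v u} → v < n → u < n → bit (c′ u ≡ᵇ c′ v) ≤ bit (β v u) + matrix F v u
  covered = below₂ (λ v u → bit (c′ u ≡ᵇ c′ v) ≤ bit (β v u) + matrix F v u) λ v u →
    subst (λ x → bit (c′ (toℕ u) ≡ᵇ c′ (toℕ v)) ≤ bit (β (toℕ v) (toℕ u)) + x) (sym (matrix-toℕ F v u)) (go v u)
    where
    bits : ∀ {a b d} → (T a → T b ⊎ T d) → bit a ≤ bit b + bit d
    bits {false} f = z≤n
    bits {true} {true} f = s≤s z≤n
    bits {true} {false} {true} f = ≤-refl
    bits {true} {false} {false} f with f _
    ... | inj₁ ()
    ... | inj₂ ()
    go : ∀ v u → bit (c′ (toℕ u) ≡ᵇ c′ (toℕ v)) ≤ bit (β (toℕ v) (toℕ u)) + bit (adj F v u)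
    go v u = bits same⇒
      where
      same⇒ : T (c′ (toℕ u) ≡ᵇ c′ (toℕ v)) → T (β (toℕ v) (toℕ u)) ⊎ T (adj F v u)
      same⇒ same with v ≟ᶠ u
      ... | yes refl = inj₁ (neighbourhood-refl G (toℕ v))
      ... | no v≢u with ∨-elim {adj G v u} (≡⇒T (Equivalence.from (cluster v u)
            (v≢u , toℕ-injective (trans (sym (c′-toℕ v)) (trans (sym (≡ᵇ-elim same)) (c′-toℕ u))))))
      ...   | inj₁ inG = inj₁ (adj⇒neighbourhood G inG)
      ...   | inj₂ inF = inj₂ inF

  missing : ∀ {v} → v < n → s ∸ degree n β v ≤ sum n (matrix F v)
  missing {v} v<n = m≤n+o⇒m∸n≤o s (degree n β v) (begin
    s                                              ≡⟨ Packing.classSize packing v<n _ ⟨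
    count n (λ u → c′ u ≡ᵇ c′ v)                   ≤⟨ sum-mono n (covered v<n) ⟩
    sum n (λ u → bit (β v u) + matrix F v u)       ≡⟨ sum-+ n (λ u → bit (β v u)) (matrix F v) ⟩
    degree n β v + sum n (matrix F v)              ∎)

m+m≤n+n⇒m≤n : ∀ {m n} → m + m ≤ n + n → m ≤ n
m+m≤n+n⇒m≤n le = ≮⇒≥ λ n<m → <⇒≱ (+-mono-< n<m n<m) le

-- `F` joins all non-adjacent pairs within a class. Since `N[v]` lies inside the class of `v`, the
-- row of `v` in `F` has exactly `s ∸ degree n β v` ones, so the deficit is twice the size of `F`.
Fits⇒UCEA : ∀ I s → Fits (graph I) (param I) s → UCEA I
Fits⇒UCEA I s (packing , small) = F , m+m≤n+n⇒m≤n F≤k , s , suc (sum n colour) , c , cluster , size≡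
  where
  open Packing packing
  G = graph I
  n = order I
  β = neighbourhood G

  F : EdgeSet n
  F .adj u v       = (colour (toℕ u) ≡ᵇ colour (toℕ v)) ∧ not (β (toℕ u) (toℕ v))
  F .adj-sym u v   = T-ext (flip-adj u v) (flip-adj v u)
    where
    flip-adj : ∀ (u v : Fin n) →
      T ((colour (toℕ u) ≡ᵇ colour (toℕ v)) ∧ not (β (toℕ u) (toℕ v))) →
      T ((colour (toℕ v) ≡ᵇ colour (toℕ u)) ∧ not (β (toℕ v) (toℕ u)))
    flip-adj u v h = ∧-intro (≡ᵇ-intro (sym (≡ᵇ-elim {colour (toℕ u)} (∧-fst h))))
      (not-intro λ vu → not-elim (∧-snd {colour (toℕ u) ≡ᵇ colour (toℕ v)} h) (neighbourhood-sym G {toℕ v} vu))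
  F .adj-irrefl v  = T-ext
    (λ h → not-elim (∧-snd {colour (toℕ v) ≡ᵇ colour (toℕ v)} h) (neighbourhood-refl G (toℕ v))) λ ()

  -- Any bound on the colours would do; their sum is one.
  c : Fin n → Fin (suc (sum n colour))
  c v = fromℕ< (s≤s (term≤sum n colour (toℕ<n v)))

  toℕ-c : ∀ v → toℕ (c v) ≡ colour (toℕ v)
  toℕ-c v = toℕ-fromℕ< _

  cluster : ∀ u v → adj (G ∪ₑ F) u v ≡ true ⇔ (u ≢ v × c u ≡ c v)
  cluster u v = mk⇔ to from
    where
    to : adj (G ∪ₑ F) u v ≡ true → u ≢ v × c u ≡ c v
    to uv = distinct , toℕ-injective (trans (toℕ-c u) (trans same (sym (toℕ-c v))))
      where
      distinct : u ≢ v
      distinct refl with () ← trans (sym uv) (adj-irrefl (G ∪ₑ F) u)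
      same : colour (toℕ u) ≡ colour (toℕ v)
      same with ∨-elim {adj G u v} (≡⇒T uv)
      ... | inj₁ inG = respects (toℕ<n u) (toℕ<n v) _ _ (adj⇒neighbourhood G inG)
      ... | inj₂ inF = ≡ᵇ-elim (∧-fst inF)
    from : u ≢ v × c u ≡ c v → adj (G ∪ₑ F) u v ≡ true
    from (u≢v , eq) with adj G u v in e
    ... | true  = refl
    ... | false = T⇒≡ (∧-intro
      (≡ᵇ-intro (trans (sym (toℕ-c u)) (trans (cong toℕ eq) (toℕ-c v))))
      (not-intro λ uv → nonadjacent (neighbourhood⇒≡⊎adj G uv)))
      where
      nonadjacent : ¬ (u ≡ v ⊎ T (adj G u v))
      nonadjacent (inj₁ u≡v) = u≢v u≡v
      nonadjacent (inj₂ inG) = subst T e inG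

  size≡ : ∀ v → ∣ fibre c (c v) ∣ ≡ s
  size≡ v = trans (∣tabulate∣ n _ (λ u → colour u ≡ᵇ colour (toℕ v)) same) (classSize (toℕ<n v) _)
    where
    same : ∀ u → does (c u ≟ᶠ c v) ≡ (colour (toℕ u) ≡ᵇ colour (toℕ v))
    same u with c u ≟ᶠ c v
    ... | yes eq = sym (T⇒≡ (≡ᵇ-intro (trans (sym (toℕ-c u)) (trans (cong toℕ eq) (toℕ-c v)))))
    ... | no neq = T-ext (λ ()) λ eq → neq (toℕ-injective
                     (trans (toℕ-c u) (trans (≡ᵇ-elim eq) (sym (toℕ-c v)))))

  filled : ∀ {v u} → v < n → u < n → bit (colour u ≡ᵇ colour v) ≡ bit (β v u) + matrix F v u
  filled = below₂ (λ v u → bit (colour u ≡ᵇ colour v) ≡ bit (β v u) + matrix F v u) λ v u →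
    trans (cong bit (T-ext (λ e → ≡ᵇ-intro (sym (≡ᵇ-elim {colour (toℕ u)} e))) (λ e → ≡ᵇ-intro (sym (≡ᵇ-elim {colour (toℕ v)} e)))))
      (trans (bits (λ vu → ≡ᵇ-intro (respects (toℕ<n v) (toℕ<n u) _ _ vu)))
             (cong (bit (β (toℕ v) (toℕ u)) +_) (sym (matrix-toℕ F v u))))
    where
    bits : ∀ {a b} → (T b → T a) → bit a ≡ bit b + bit (a ∧ not b)
    bits {true}  {true}  _ = refl
    bits {true}  {false} _ = refl
    bits {false} {true}  f = ⊥-elim (f _)
    bits {false} {false} _ = refl

  row : ∀ {v} → v < n → sum n (matrix F v) ≡ s ∸ degree n β v
  row {v} v<n = sym (begin
    s ∸ degree n β v                                                ≡⟨ cong (_∸ degree n β v) (classSize v<n _) ⟨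
    count n (λ u → colour u ≡ᵇ colour v) ∸ degree n β v             ≡⟨ cong (_∸ degree n β v) (sum-cong n (filled v<n)) ⟩
    sum n (λ u → bit (β v u) + matrix F v u) ∸ degree n β v         ≡⟨ cong (_∸ degree n β v) (sum-+ n (λ u → bit (β v u)) (matrix F v)) ⟩
    degree n β v + sum n (matrix F v) ∸ degree n β v                ≡⟨ m+n∸m≡n (degree n β v) _ ⟩
    sum n (matrix F v)                                              ∎)
    where open ≡-Reasoning

  F≤k : ∣ F ∣ₑ + ∣ F ∣ₑ ≤ param I + param I
  F≤k = begin
    ∣ F ∣ₑ + ∣ F ∣ₑ                    ≡⟨ double-edges F ⟨
    sum n (λ v → sum n (matrix F v))   ≡⟨ sum-cong n row ⟩
    deficit n β s                      ≤⟨ small ⟩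
    param I + param I                  ∎
    where open ≤-Reasoning

-- Correctness of the deletions

-- A sum, to agree literally with the machine expression `fiveK`: the machine cannot multiply.
five : ℕ → ℕ
five k = k + k + k + k + k

2k≤5k : ∀ k → k + k ≤ five k
2k≤5k k = ≤-trans (m≤m+n (k + k) k) (≤-trans (m≤m+n _ k) (m≤m+n _ k))

4k≤5k : ∀ k → k + k + (k + k) ≤ five k
4k≤5k k = ≤-trans (≤-reflexive (sym (+-assoc (k + k) k k))) (m≤m+n _ k)

count-everything : ∀ n → count n everything ≡ n
count-everything zero    = refl
count-everything (suc n) = cong suc (count-everything n)

packing-antimono : ∀ {n K β β′ s} → (∀ {u v} → u < n → v < n → T (β′ u v) → T (β u v)) →
  Packing n K β s → Packing n K β′ s
packing-antimono imp P = record
  { colour    = colour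
  ; respects  = λ u<n v<n ku kv uv → respects u<n v<n ku kv (imp u<n v<n uv)
  ; classSize = classSize
  } where open Packing P

-- With more than 2k vertices some vertex is untouched, and the clique size is
-- its closed degree.
Fits-unique : ∀ I s → param I + param I < order I →
  let β = neighbourhood (graph I) in
  (∀ {v} → v < order I → degree (order I) β v ≤ s) → deficit (order I) β s ≤ param I + param I →
  ∀ s′ → Fits (graph I) (param I) s′ → s′ ≡ s
Fits-unique I s 2k<n le small s′ (P , small′) =
  size-unique (≤-<-trans small′ 2k<n) (packing⇒degree≤ P) (≤-<-trans small 2k<n) le

module _ (I : Instance) (s : ℕ) where

  private
    n = order I
    k = param I
    β = neighbourhood (graph I)

  -- The state of the deletion loop before its i-th round, where K is the set
  -- of the remaining vertices.  Deleting s vertices only while more than 5k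
  -- remain keeps s + |K| above 5k.
  record Progress (i : ℕ) (K : ℕ → Bool) : Set where
    field
      stable   : Closed n β K
      budget   : five k < s + count n K
      finished : ∀ {v} → v < i → v < n → Good n β s v → T (K v) → count n K ≤ five k
      to       : Packing n everything β s → Packing n K β s
      from     : Packing n K β s → Packing n everything β s

  open Progress

  start : five k < n → Progress 0 everything
  start 5k<n .stable _ _ _ _ = _
  start 5k<n .budget         = subst (λ x → five k < s + x) (sym (count-everything n)) (≤-trans 5k<n (m≤n+m n s))
  start 5k<n .finished ()
  start 5k<n .to P   = P
  start 5k<n .from P = P

  -- The hypothesis covers the three reasons to pass over `v`: it is not good, it has already been
  -- deleted, or the threshold 5k has been reached.
  skip-vertex : ∀ {v K} → (Good n β s v → T (K v) → count n K ≤ five k) →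
    Progress v K → Progress (suc v) K
  skip-vertex {v} {K} done p = record
    { stable   = stable p
    ; budget   = budget p
    ; finished = fin
    ; to       = to p
    ; from     = from p
    }
    where
    fin : ∀ {u} → u < suc v → u < n → Good n β s u → T (K u) → count n K ≤ five k
    fin {u} u<1+v u<n good ku with u ≟ v
    ... | yes refl = done good ku
    ... | no u≢v   = finished p (≤∧≢⇒< (s≤s⁻¹ u<1+v) u≢v) u<n good ku

  without : (ℕ → Bool) → ℕ → ℕ → Bool
  without K v u = K u ∧ not (β v u)

  delete-count : ∀ {v K} → v < n → T (K v) → Good n β s v → Progress v K →
    count n K ≡ s + count n (without K v)
  delete-count v<n kv good p = Deletion.count≡
    (λ {u} → neighbourhood-sym (graph I) {u}) (neighbourhood-refl (graph I)) (stable p) v<n kv good (λ _ → refl)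

  delete-vertex : ∀ {v K} → v < n → T (K v) → Good n β s v → five k < count n K →
    Progress v K → Progress (suc v) (without K v)
  delete-vertex {v} {K} v<n kv good many p = record
    { stable   = closed′
    ; budget   = subst (five k <_) count≡ many
    ; finished = fin
    ; to       = λ P → shrink (to p P)
    ; from     = λ P → from p (extend P)
    }
    where
    open Deletion (λ {u} → neighbourhood-sym (graph I) {u}) (neighbourhood-refl (graph I))
      {K} {without K v} (stable p) v<n kv good (λ _ → refl)
    fin : ∀ {u} → u < suc v → u < n → Good n β s u → T (without K v u) → count n (without K v) ≤ five k
    fin {u} u<1+v u<n good′ ku with u ≟ v
    ... | yes refl = ⊥-elim (deleted ku)
    -- Had an earlier good vertex survived until now, the threshold would already have been reached,
    -- against `many`.
    ... | no u≢v   = contradiction many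
      (≤⇒≯ (finished p (≤∧≢⇒< (s≤s⁻¹ u<1+v) u≢v) u<n good′ (subset u<n ku)))

  module Decision {K : ℕ → Bool} (p : Progress n K) (5k<n : five k < n)
    (max : ∀ {v} → v < n → degree n β v ≤ s)
    (least : ∀ b → (∀ {v} → v < n → degree n β v ≤ b) → s ≤ b) where

    private
      2k<n : k + k < n
      2k<n = ≤-<-trans (2k≤5k k) 5k<n

    -- The clique size of a solution bounds all degrees and so is at least `s`, and the deficit is
    -- monotone in the size.
    UCEA⇒deficit≤ : UCEA I → deficit n β s ≤ k + k
    UCEA⇒deficit≤ yes! = let (s′ , P , small) = UCEA⇒Fits I yes! in
      ≤-trans (sum-mono n λ {v} _ → ∸-monoˡ-≤ (degree n β v) (least s′ (packing⇒degree≤ P))) small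

    UCEA⇒packing : UCEA I → Packing n everything β s
    UCEA⇒packing yes! = let (s′ , fits) = UCEA⇒Fits I yes! in
      subst (Packing n everything β) (Fits-unique I s 2k<n max (UCEA⇒deficit≤ yes!) s′ fits) (proj₁ fits)

    -- If more than 5k vertices were left, none of them would be good. Each would then have degree
    -- below `s` and add at least 1 to a deficit of at most 2k.
    UCEA⇒count≤ : UCEA I → count n K ≤ five k
    UCEA⇒count≤ yes! = ≮⇒≥ λ many → <⇒≱ many
      (≤-trans (sum-mono n (λ {v} → remaining many {v})) (≤-trans (UCEA⇒deficit≤ yes!) (2k≤5k k)))
      where
      P = UCEA⇒packing yes!
      remaining : five k < count n K → ∀ {v} → v < n → bit (K v) ≤ s ∸ degree n β v
      remaining many {v} v<n with K v in kv
      ... | false = z≤n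
      ... | true  = m<n⇒0<n∸m (≤∧≢⇒< (max v<n) λ d≡s →
        <⇒≱ many (finished p v<n v<n (packing⇒good P v<n d≡s) (≡⇒T kv)))

    -- The class of a remaining vertex lies within `K`, so `s` would be at most 2k as well, and
    -- `budget` excludes that `s` and `count n K` sum to 4k or less.
    UCEA⇒count≡0 : UCEA I → count n K ≤ k + k → count n K ≡ 0
    UCEA⇒count≡0 yes! few = n≤0⇒n≡0 (≮⇒≥ λ pos →
      let P = to p (UCEA⇒packing yes!)
          (v , v<n , kv) = count>0⇒∃ n K pos
          s≤m = subst (_≤ count n K) (Packing.classSize P v<n kv)
                  (count-mono n {λ u → K u ∧ (Packing.colour P u ≡ᵇ Packing.colour P v)} {K} (λ _ → ∧-fst))
      in <⇒≱ (budget p) (≤-trans (+-mono-≤ (≤-trans s≤m few) few) (4k≤5k k)))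

    module _ (pos : ℕ → ℕ) (pos-rank : ∀ {v} → v < n → T (K v) → pos (rank K v) ≡ v) where

      open Relabelling {s = s} K (stable p) pos pos-rank

      induced : Graph m
      induced .adj u v      = 0 <ᵇ matrix (graph I) (pos (toℕ u)) (pos (toℕ v))
      induced .adj-sym u v  = cong (0 <ᵇ_) (matrix-sym (graph I) (pos (toℕ u)) (pos (toℕ v)))
      induced .adj-irrefl v = cong (0 <ᵇ_) (matrix-irrefl (graph I) (pos (toℕ v)))

      kernel : Instance
      kernel .order   = m
      kernel .graph   = induced
      kernel .param   = k
      kernel .param>0 = param>0 I

      neighbourhood-induced : ∀ {u v} → u < m → v < m → neighbourhood induced u v ≡ β′ u v
      neighbourhood-induced {u} {v} u<m v<m = cong₂ _∨_
        (T-ext (λ e → ≡ᵇ-intro (cong pos (≡ᵇ-elim {u} e)))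
               (λ e → ≡ᵇ-intro (pos-injective u<m v<m (≡ᵇ-elim {pos u} e))))
        (below₂ (λ u v → (0 <ᵇ matrix induced u v) ≡ (0 <ᵇ matrix (graph I) (pos u) (pos v))) bits u<m v<m)
        where
        bits : ∀ (u v : Fin m) → (0 <ᵇ matrix induced (toℕ u) (toℕ v)) ≡
                                 (0 <ᵇ matrix (graph I) (pos (toℕ u)) (pos (toℕ v)))
        bits u v rewrite matrix-toℕ induced u v with 0 <ᵇ matrix (graph I) (pos (toℕ u)) (pos (toℕ v))
        ... | true  = refl
        ... | false = refl

      degree-induced : ∀ {v} → v < m → degree m (neighbourhood induced) v ≡ degree m β′ v
      degree-induced v<m = sum-cong m λ u<m → cong bit (neighbourhood-induced v<m u<m)

      deficit-induced : deficit m (neighbourhood induced) s ≤ deficit n β s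
      deficit-induced = ≤-trans (≤-reflexive (sum-cong m λ v<m → cong (s ∸_) (degree-induced v<m))) deficit′≤

      packing⇒induced : Packing n K β s → Packing m everything (neighbourhood induced) s
      packing⇒induced P = packing-antimono (λ u<m v<m → subst T (neighbourhood-induced u<m v<m)) (relabel P)

      induced⇒packing : Packing m everything (neighbourhood induced) s → Packing n K β s
      induced⇒packing P = unrelabel
        (packing-antimono (λ u<m v<m → subst T (sym (neighbourhood-induced u<m v<m))) P)

      -- The two hypotheses are what the program tests. As `small` already settles the deficit of
      -- `I`, the backward direction needs from the kernel only a packing of size `s`.
      kernel-correct : deficit n β s ≤ k + k → (m ≤ k + k → m ≡ 0) → UCEA I ⇔ UCEA kernel
      kernel-correct small large = mk⇔
        (λ yes! → Fits⇒UCEA kernel s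
           (packing⇒induced (to p (UCEA⇒packing yes!)) , ≤-trans deficit-induced small))
        (λ yes! → Fits⇒UCEA I s (from p (induced⇒packing (packing′ yes!)) , small))
        where
        packing′ : UCEA kernel → Packing m everything (neighbourhood induced) s
        packing′ yes! with m ≤? k + k
        ... | yes few = record
          { colour    = λ v → v
          ; respects  = λ u<m → case-empty u<m
          ; classSize = λ v<m → case-empty v<m
          }
          where
          case-empty : ∀ {A : Set} {v} → v < m → A
          case-empty v<m with () ← subst (_ <_) (large few) v<m
        -- Enough vertices are left for the size of any solution of the kernel to be the old `s`.
        ... | no many = let (s′ , fits) = UCEA⇒Fits kernel yes! in
          subst (Packing m everything (neighbourhood induced))
            (Fits-unique kernel s (≰⇒> many)
              (λ v<m → subst (_≤ s) (sym (degree-induced v<m)) (degree′≤ max v<m))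
              (≤-trans deficit-induced small) s′ fits)
            (proj₁ fits)

-- The program

-- Leads from the middle of an inner loop back to the start of the outer one.
frame-nested : ∀ {x C σ τ υ} → Frame (for x C) σ τ → Frame C τ υ → Frame (for x C) σ υ
frame-nested {x} F G =
  (λ y eq → trans (vars≡ G y (proj₂ (∨-false {does (y ≟ x)} eq))) (vars≡ F y eq)) ,
  (λ a eq p q → trans (arrays≡ G a eq p q) (arrays≡ F a eq p q))

accumulate : ∀ n x C acc σ (f : ℕ → ℕ) → writes C x ≡ false → does (acc ≟ x) ≡ false →
  (∀ i τ → i < n → vars τ x ≡ i → Frame (for x C) σ τ →
     vars (run n C τ) acc ≡ vars τ acc + f i) →
  vars (run n (for x C) σ) acc ≡ vars σ acc + sum n f
accumulate n x C acc σ f kept acc≢x step =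
  for-rule n x C σ (λ i τ → vars τ acc ≡ vars σ acc + sum i f) kept
    (trans (setVar-other 0 σ acc≢x) (sym (+-identityʳ _)))
    λ i τ i<n x≡i F inv → begin
      vars (tick x (run n C τ)) acc       ≡⟨ setVar-other _ (run n C τ) acc≢x ⟩
      vars (run n C τ) acc                ≡⟨ step i τ i<n x≡i F ⟩
      vars τ acc + f i                    ≡⟨ cong (_+ f i) inv ⟩
      vars σ acc + sum i f + f i          ≡⟨ +-assoc (vars σ acc) _ _ ⟩
      vars σ acc + (sum i f + f i)        ≡⟨ cong (vars σ acc +_) (+-comm (sum i f) (f i)) ⟩
      vars σ acc + sum (suc i) f          ∎
  where open ≡-Reasoning

fill : Name → Expr → Cmd
fill a e = for 10 (for 11 (a [ var 10 , var 11 ]:= e))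

-- `value` is required in every state that agrees with `σ` outside array `a` and the two counters,
-- so cells that are already overwritten cannot influence `e`.
fill-correct : ∀ n a e σ (f : ℕ → ℕ → ℕ) →
  (∀ {i j} τ → i < n → j < n → vars τ 10 ≡ i → vars τ 11 ≡ j → Frame (fill a e) σ τ → eval τ e ≡ f i j) →
  ∀ {p q} → p < n → q < n → arrays (run n (fill a e) σ) a p q ≡ f p q
fill-correct n a e σ f value = for-rule n 10 (for 11 store-e) σ Outer refl (λ ()) outer
  where
  store-e = a [ var 10 , var 11 ]:= e
  Outer : ℕ → State → Set
  Outer i τ = ∀ {p q} → p < i → q < n → arrays τ a p q ≡ f p q

  outer : ∀ i τ → i < n → vars τ 10 ≡ i → Frame (fill a e) σ τ → Outer i τ →
    Outer (suc i) (tick 10 (run n (for 11 store-e) τ))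
  outer i τ i<n 10≡i F done {p} {q} p<1+i q<n = result
    where
    Row : ℕ → State → Set
    Row j υ = Outer i υ × (∀ {q} → q < j → arrays υ a i q ≡ f i q)

    row : Row n (run n (for 11 store-e) τ)
    row = for-rule n 11 store-e τ Row refl ((λ p<i q<n → done p<i q<n) , λ ()) inner
      where
      inner : ∀ j υ → j < n → vars υ 11 ≡ j → Frame (for 11 store-e) τ υ → Row j υ →
        Row (suc j) (tick 11 (run n store-e υ))
      inner j υ j<n 11≡j G (above , left)
        rewrite trans (vars≡ G 10 refl) 10≡i | 11≡j
              | value υ i<n j<n (trans (vars≡ G 10 refl) 10≡i) 11≡j (frame-nested F G) =
        (λ {p} {q} p<i q<n → trans (setCell-other-row a j (f i j) υ q (<⇒≢ p<i)) (above p<i q<n)) , left′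
        where
        left′ : ∀ {q} → q < suc j → arrays (setCell a i j (f i j) υ) a i q ≡ f i q
        left′ {q} q<1+j with q ≟ j
        ... | yes refl = setCell-same a i j (f i j) υ
        ... | no q≢j   = trans (setCell-other-column a i (f i j) υ i q≢j) (left (≤∧≢⇒< (s≤s⁻¹ q<1+j) q≢j))

    result : arrays (run n (for 11 store-e) τ) a p q ≡ f p q
    result with p ≟ i
    ... | yes refl = proj₂ row q<n
    ... | no p≢i   = proj₁ row (≤∧≢⇒< (s≤s⁻¹ p<1+i) p≢i) q<n

-- The two truncated differences add up to the distance, and 1 minus the distance is the equality
-- bit.
equal : Expr → Expr → Expr
equal d e = lit 1 ⊖ (d ⊖ e ⊕ (e ⊖ d))

equal-bit : ∀ i j → 1 ∸ (i ∸ j + (j ∸ i)) ≡ bit (i ≡ᵇ j)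
equal-bit zero    zero    = refl
equal-bit zero    (suc j) = 0∸n≡0 j
equal-bit (suc i) zero    = 0∸n≡0 (i + 0)
equal-bit (suc i) (suc j) = equal-bit i j

fiveK : Expr
fiveK = var 1 ⊕ var 1 ⊕ var 1 ⊕ var 1 ⊕ var 1

-- Variables: 0 the order, 1 the parameter, 3 a degree, 4 the clique size s,
-- 5 the deficit, 6 the number of remaining vertices, 7 zero if the vertex in 10
-- is to be deleted, 8 the next free rank, 9 zero if the kernel is the induced
-- subgraph, 10 to 12 loop counters.
-- Arrays: 0 input and output, 1 non-zero on deleted vertices, 2 the closed
-- neighbourhoods, 3 the remaining vertices by rank, 4 the degrees.
addEntry addDeficit addViolation mark list : Cmd
addEntry     = 3 := var 3 ⊕ 2 [ var 10 , var 11 ]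
addDeficit   = 5 := var 5 ⊕ (var 4 ⊖ 4 [ var 10 , lit 0 ])
-- All entries are bits: the summand is 1 exactly when v is joined to u and u to w, but v not to w.
addViolation = 7 := var 7 ⊕ (2 [ var 10 , var 11 ] ⊕ 2 [ var 11 , var 12 ] ⊖ lit 1 ⊖ 2 [ var 10 , var 12 ])
mark         = 1 [ var 11 , lit 0 ]:= 1 [ var 11 , lit 0 ] ⊕ 2 [ var 10 , var 11 ]
list         = 3 [ var 8 , lit 0 ]:= var 10 ▸ 8 := lit 1 ⊕ var 8

measureRow closeUp measure sumDeficit test remove delete enumerate judge induce reduce : Cmd
closeUp    = fill 2 (0 [ var 10 , var 11 ] ⊕ equal (var 10) (var 11))
-- The last assignment replaces variable 4 by the maximum of variables 3 and 4.
measureRow = 3 := lit 0 ▸ for 11 addEntry ▸ 4 [ var 10 , lit 0 ]:= var 3 ▸ 4 := var 4 ⊕ (var 3 ⊖ var 4)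
measure    = for 10 measureRow
sumDeficit = for 10 addDeficit
-- A conjunction coded as the vanishing of a sum: v is unmarked, has full degree, more than 5k
-- vertices remain (hence the `lit 1`), and no edge leaves its closed neighbourhood.
test       = 7 := 1 [ var 10 , lit 0 ] ⊕ (var 4 ⊖ 4 [ var 10 , lit 0 ]) ⊕ (lit 1 ⊕ fiveK ⊖ var 6) ▸
             for 11 (for 12 addViolation)
remove     = 6 := var 6 ⊖ var 4 ▸ for 11 mark
delete     = for 10 (test ▸ unless (var 7) remove)
enumerate  = for 10 (unless (1 [ var 10 , lit 0 ]) list)
-- Zero means that the deficit is at most 2k, at most 5k vertices remain, and a remainder of at most
-- 2k is empty.
judge      = 9 := (var 5 ⊖ (var 1 ⊕ var 1)) ⊕ (var 6 ⊖ fiveK) ▸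
             unless (var 6 ⊖ (var 1 ⊕ var 1)) (9 := var 9 ⊕ var 6)
induce     = fill 0 (2 [ 3 [ var 10 , lit 0 ] , 3 [ var 11 , lit 0 ] ] ⊖ equal (var 10) (var 11))
reduce     = closeUp ▸ measure ▸ sumDeficit ▸ 6 := var 0 ▸ delete ▸ enumerate ▸ judge ▸ induce

module Program (I : Instance) where

  n = order I
  k = param I
  β = neighbourhood (graph I)

  Stored : State → Set
  Stored τ = ∀ {u v} → u < n → v < n → arrays τ 2 u v ≡ bit (β u v)

  stored-frame : ∀ {C σ τ} → fills C 2 ≡ false → Frame C σ τ → Stored σ → Stored τ
  stored-frame eq F st u<n v<n = trans (arrays≡ F 2 eq _ _) (st u<n v<n)

  closeUp-correct : ∀ σ → (∀ u v → arrays σ 0 u v ≡ matrix (graph I) u v) → Stored (run n closeUp σ)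
  closeUp-correct σ inp = fill-correct n 2 _ σ (λ u v → bit (β u v)) value
    where
    open ≡-Reasoning
    bits : ∀ i j → bit (0 <ᵇ matrix (graph I) i j) + bit (i ≡ᵇ j) ≡ bit (β i j)
    bits i j with i ≡ᵇ j in eq
    ... | false = +-identityʳ _
    ... | true with refl ← ≡ᵇ-elim {i} {j} (≡⇒T eq) rewrite matrix-irrefl (graph I) i = refl
    value : ∀ {i j} τ → i < n → j < n → vars τ 10 ≡ i → vars τ 11 ≡ j → Frame closeUp σ τ →
      eval τ (0 [ var 10 , var 11 ] ⊕ equal (var 10) (var 11)) ≡ bit (β i j)
    value {i} {j} τ _ _ refl refl F = begin
      arrays τ 0 i j + (1 ∸ (i ∸ j + (j ∸ i)))        ≡⟨ cong₂ _+_ (trans (arrays≡ F 0 refl i j) (inp i j)) (equal-bit i j) ⟩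
      matrix (graph I) i j + bit (i ≡ᵇ j)             ≡⟨ cong (_+ bit (i ≡ᵇ j)) (matrix-bit (graph I) i j) ⟩
      bit (0 <ᵇ matrix (graph I) i j) + bit (i ≡ᵇ j)  ≡⟨ bits i j ⟩
      bit (β i j)                                     ∎

  -- Variable 4 is described as a least upper bound of the degrees, a form that its initial value 0
  -- satisfies half of and that each further row preserves.
  record Measured (τ : State) : Set where
    field
      degrees : ∀ {v} → v < n → arrays τ 4 v 0 ≡ degree n β v
      bound   : ∀ {v} → v < n → degree n β v ≤ vars τ 4
      least   : ∀ b → (∀ {v} → v < n → degree n β v ≤ b) → vars τ 4 ≤ b

  measure-correct : ∀ σ → Stored σ → vars σ 4 ≡ 0 → Measured (run n measure σ)
  measure-correct σ st 4≡0 = let (a , b , c) = for-rule n 10 measureRow σ Inv refl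
                                    ((λ ()) , (λ ()) , λ b _ → subst (_≤ b) (sym 4≡0) z≤n) step
    in record { degrees = a ; bound = b ; least = c }
    where
    Inv : ℕ → State → Set
    Inv i τ = (∀ {v} → v < i → arrays τ 4 v 0 ≡ degree n β v) ×
              (∀ {v} → v < i → degree n β v ≤ vars τ 4) ×
              (∀ b → (∀ {v} → v < n → degree n β v ≤ b) → vars τ 4 ≤ b)
    count-row = for 11 addEntry

    step : ∀ i τ → i < n → vars τ 10 ≡ i → Frame measure σ τ → Inv i τ → Inv (suc i) (tick 10 (run n measureRow τ))
    step i τ i<n refl F (degs , bnd , lst) =
      (λ {v} v<1+i → trans (cong₂ (λ p x → arrays (setCell 4 p 0 x υ) 4 v 0) (vars≡ rowFrame 10 refl) degree≡)
                           (degs′ v<1+i)) ,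
      (λ {v} v<1+i → subst (degree n β v ≤_) (sym maximum) (bnd′ v<1+i)) ,
      (λ b ub → subst (_≤ b) (sym maximum) (lst′ b ub))
      where
      d = degree n β i
      υ = run n count-row (setVar 3 0 τ)
      s = vars τ 4
      degree≡ : vars υ 3 ≡ d
      degree≡ = trans (accumulate n 11 addEntry 3 (setVar 3 0 τ) (λ j → arrays τ 2 i j) refl refl
          λ where
            j υ _ refl G → cong (vars υ 3 +_)
              (trans (arrays≡ G 2 refl _ _) (cong (λ x → arrays τ 2 x j) (vars≡ G 10 refl))))
        (sum-cong n λ j<n → stored-frame {C = measure} refl F st i<n j<n)
      rowFrame = frame n count-row (setVar 3 0 τ)
      maximum : vars υ 4 + (vars υ 3 ∸ vars υ 4) ≡ s + (d ∸ s)
      maximum = cong₂ (λ x y → y + (x ∸ y)) degree≡ (vars≡ rowFrame 4 refl)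
      degs′ : ∀ {v} → v < suc i → arrays (setCell 4 i 0 d υ) 4 v 0 ≡ degree n β v
      degs′ {v} v<1+i with v ≟ i
      ... | yes refl = setCell-same 4 i 0 d υ
      ... | no v≢i   = trans (setCell-other-row 4 0 d υ 0 v≢i)
        (trans (arrays≡ rowFrame 4 refl v 0) (degs (≤∧≢⇒< (s≤s⁻¹ v<1+i) v≢i)))
      bnd′ : ∀ {v} → v < suc i → degree n β v ≤ s + (d ∸ s)
      bnd′ {v} v<1+i with v ≟ i
      ... | yes refl = m≤n+m∸n d s
      ... | no v≢i   = ≤-trans (bnd (≤∧≢⇒< (s≤s⁻¹ v<1+i) v≢i)) (m≤m+n s _)
      lst′ : ∀ b → (∀ {v} → v < n → degree n β v ≤ b) → s + (d ∸ s) ≤ b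
      lst′ b ub with ≤-total s d
      ... | inj₁ s≤d = subst (_≤ b) (sym (m+[n∸m]≡n s≤d)) (ub i<n)
      ... | inj₂ d≤s = subst (_≤ b) (sym (trans (cong (s +_) (m≤n⇒m∸n≡0 d≤s)) (+-identityʳ s))) (lst b ub)

  measured-frame : ∀ {C σ τ} → fills C 4 ≡ false → writes C 4 ≡ false → Frame C σ τ → Measured σ → Measured τ
  measured-frame {σ = σ} {τ} eq eq′ F M = record
    { degrees = λ v<n → trans (arrays≡ F 4 eq _ _) (degrees v<n)
    ; bound   = λ v<n → subst (_ ≤_) (sym (vars≡ F 4 eq′)) (bound v<n)
    ; least   = λ b ub → subst (_≤ b) (sym (vars≡ F 4 eq′)) (least b ub)
    } where open Measured M

  sumDeficit-correct : ∀ σ → Measured σ → vars σ 5 ≡ 0 → vars (run n sumDeficit σ) 5 ≡ deficit n β (vars σ 4)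
  sumDeficit-correct σ M 5≡0 = trans
    (accumulate n 10 addDeficit 5 σ (λ v → vars σ 4 ∸ arrays σ 4 v 0) refl refl λ where
      v τ _ refl F → cong (vars τ 5 +_) (cong₂ _∸_ (vars≡ F 4 refl) (arrays≡ F 4 refl v 0)))
    (cong₂ _+_ 5≡0 (sum-cong n λ {v} v<n → cong (vars σ 4 ∸_) (Measured.degrees M v<n)))

  obstruction : State → ℕ → ℕ
  obstruction τ v =
    arrays τ 1 v 0 + (vars τ 4 ∸ degree n β v) + (suc (five k) ∸ vars τ 6) +
    sum n (λ u → sum n (λ w → bit (β v u) + bit (β u w) ∸ 1 ∸ bit (β v w)))

  test-correct : ∀ τ {v} → v < n → vars τ 10 ≡ v → vars τ 1 ≡ k → Stored τ → Measured τ →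
    vars (run n test τ) 7 ≡ obstruction τ v
  test-correct τ {v} v<n refl 1≡k st M =
    trans (accumulate n 11 (for 12 addViolation) 7 τ₁ _ refl refl outer)
      (cong₂ (λ d k → arrays τ 1 v 0 + (vars τ 4 ∸ d) + (suc (five k) ∸ vars τ 6) +
              sum n (λ u → sum n (λ w → bit (β v u) + bit (β u w) ∸ 1 ∸ bit (β v w))))
             (Measured.degrees M v<n) 1≡k)
    where
    τ₁ = run n (7 := 1 [ var 10 , lit 0 ] ⊕ (var 4 ⊖ 4 [ var 10 , lit 0 ]) ⊕ (lit 1 ⊕ fiveK ⊖ var 6)) τ
    inner = for 12 addViolation

    outer : ∀ u υ → u < n → vars υ 11 ≡ u → Frame (for 11 inner) τ₁ υ →
      vars (run n inner υ) 7 ≡ vars υ 7 + sum n (λ w → bit (β v u) + bit (β u w) ∸ 1 ∸ bit (β v w))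
    outer u υ u<n refl F = accumulate n 12 addViolation 7 υ _ refl refl λ where
      w ω w<n refl G → let
        10≡v = trans (vars≡ G 10 refl) (vars≡ F 10 refl)
        11≡u = vars≡ G 11 refl
        cell : ∀ {x y} → x < n → y < n → arrays ω 2 x y ≡ bit (β x y)
        cell x<n y<n = trans (arrays≡ G 2 refl _ _) (trans (arrays≡ F 2 refl _ _) (st x<n y<n))
        in cong (vars ω 7 +_) (cong₂ _∸_
             (cong (_∸ 1) (cong₂ _+_ (trans (cong₂ (arrays ω 2) 10≡v 11≡u) (cell v<n u<n))
                                     (trans (cong (λ x → arrays ω 2 x w) 11≡u) (cell u<n w<n))))
             (trans (cong (λ x → arrays ω 2 x w) 10≡v) (cell v<n w<n)))

  remove-correct : ∀ τ {v} → v < n → vars τ 10 ≡ v → Stored τ →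
    ∀ {u} → u < n → arrays (run n remove τ) 1 u 0 ≡ arrays τ 1 u 0 + bit (β v u)
  remove-correct τ {v} v<n refl st u<n = proj₁ (for-rule n 11 mark τ₁ Inv refl ((λ ()) , λ _ → refl) step) u<n
    where
    τ₁ = setVar 6 (vars τ 6 ∸ vars τ 4) τ
    Inv : ℕ → State → Set
    Inv i υ = (∀ {u} → u < i → arrays υ 1 u 0 ≡ arrays τ 1 u 0 + bit (β v u)) ×
              (∀ {u} → i ≤ u → arrays υ 1 u 0 ≡ arrays τ 1 u 0)
    step : ∀ i υ → i < n → vars υ 11 ≡ i → Frame (for 11 mark) τ₁ υ → Inv i υ →
      Inv (suc i) (tick 11 (run n mark υ))
    step i υ i<n refl F (done , todo) = done′ , todo′
      where
      new = arrays υ 1 i 0 + arrays υ 2 (vars υ 10) i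
      done′ : ∀ {u} → u < suc i → arrays (setCell 1 i 0 new υ) 1 u 0 ≡ arrays τ 1 u 0 + bit (β v u)
      done′ {u} u<1+i with u ≟ i
      ... | yes refl = trans (setCell-same 1 i 0 new υ) (cong₂ _+_ (todo ≤-refl)
        (trans (cong (λ x → arrays υ 2 x i) (vars≡ F 10 refl)) (trans (arrays≡ F 2 refl _ _) (st v<n i<n))))
      ... | no u≢i = trans (setCell-other-row 1 0 new υ 0 u≢i) (done (≤∧≢⇒< (s≤s⁻¹ u<1+i) u≢i))
      todo′ : ∀ {u} → suc i ≤ u → arrays (setCell 1 i 0 new υ) 1 u 0 ≡ arrays τ 1 u 0
      todo′ {u} i<u = trans (setCell-other-row 1 0 new υ 0 (>⇒≢ i<u)) (todo (<⇒≤ i<u))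

  record Kept (s : ℕ) (i : ℕ) (τ : State) : Set where
    field
      K         : ℕ → Bool
      marks     : ∀ {u} → u < n → K u ≡ (arrays τ 1 u 0 ≡ᵇ 0)
      remaining : vars τ 6 ≡ count n K
      progress  : Progress I s i K

  obstruction≡0⇒ : ∀ {τ v} → v < n → obstruction τ v ≡ 0 → (∀ {v} → v < n → degree n β v ≤ vars τ 4) →
    arrays τ 1 v 0 ≡ 0 × Good n β (vars τ 4) v × five k < vars τ 6
  obstruction≡0⇒ {τ} {v} v<n eq max =
    m+n≡0⇒m≡0 _ abc ,
    record { degree≡ = ≤-antisym (max v<n) (m∸n≡0⇒m≤n (m+n≡0⇒n≡0 (arrays τ 1 v 0) (m+n≡0⇒m≡0 _ ab)))
           ; closed  = closed′ } ,
    m∸n≡0⇒m≤n (m+n≡0⇒n≡0 (arrays τ 1 v 0 + (vars τ 4 ∸ degree n β v)) ab)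
    where
    ab  = m+n≡0⇒m≡0 _ eq
    abc = m+n≡0⇒m≡0 _ ab
    sums : sum n (λ u → sum n (λ w → bit (β v u) + bit (β u w) ∸ 1 ∸ bit (β v w))) ≡ 0
    sums = m+n≡0⇒n≡0 (arrays τ 1 v 0 + (vars τ 4 ∸ degree n β v) + (suc (five k) ∸ vars τ 6)) eq
    bits : ∀ {a b c} → bit a + bit b ∸ 1 ∸ bit c ≤ 0 → T a → T b → T c
    bits {true} {true} {true} _ _ _ = _
    closed′ : Closed n β (β v)
    closed′ {u} {w} u<n w<n uw vu = bits {β v u} {β u w} (≤-trans
      (term≤sum n (λ w → bit (β v u) + bit (β u w) ∸ 1 ∸ bit (β v w)) w<n)
      (≤-trans (term≤sum n (λ u → sum n (λ w → bit (β v u) + bit (β u w) ∸ 1 ∸ bit (β v w))) u<n)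
        (≤-reflexive sums))) vu uw

  ⇒obstruction≡0 : ∀ {τ v} → v < n → arrays τ 1 v 0 ≡ 0 → Good n β (vars τ 4) v → five k < vars τ 6 →
    obstruction τ v ≡ 0
  ⇒obstruction≡0 {τ} {v} v<n kept good many = cong₂ _+_
    (cong₂ _+_ (cong₂ _+_ kept (trans (cong (vars τ 4 ∸_) (Good.degree≡ good)) (n∸n≡0 (vars τ 4))))
               (m≤n⇒m∸n≡0 many))
    (sum≡0 n λ u<n → sum≡0 n λ w<n → bits λ vu uw → Good.closed good u<n w<n uw vu)
    where
    bits : ∀ {a b c} → (T a → T b → T c) → bit a + bit b ∸ 1 ∸ bit c ≡ 0
    bits {false} {false} {c}     _ = 0∸n≡0 (bit c)
    bits {false} {true}  {c}     _ = 0∸n≡0 (bit c)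
    bits {true}  {false} {c}     _ = 0∸n≡0 (bit c)
    bits {true}  {true}  {true}  _ = refl
    bits {true}  {true}  {false} f = ⊥-elim (f _ _)

  delete-correct : ∀ σ → vars σ 1 ≡ k → vars σ 6 ≡ n → (∀ u → arrays σ 1 u 0 ≡ 0) → five k < n →
    Stored σ → Measured σ → Kept (vars σ 4) n (run n delete σ)
  delete-correct σ 1≡k 6≡n none 5k<n st M = for-rule n 10 (test ▸ unless (var 7) remove) σ (Kept s) refl initial step
    where
    s = vars σ 4
    initial : Kept s 0 (setVar 10 0 σ)
    initial = record
      { K         = everything
      ; marks     = λ {u} _ → cong (_≡ᵇ 0) (sym (none u))
      ; remaining = trans 6≡n (sym (count-everything n))
      ; progress  = start I s 5k<n
      }

    step : ∀ v τ → v < n → vars τ 10 ≡ v → Frame delete σ τ → Kept s v τ →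
      Kept s (suc v) (tick 10 (run n (test ▸ unless (var 7) remove) τ))
    step v τ v<n 10≡v F kept with vars (run n test τ) 7 in val
    ... | suc _ = record
      { K         = K
      ; marks     = λ u<n → trans (marks u<n) (cong (_≡ᵇ 0) (sym (arrays≡ (frame n test τ) 1 refl _ 0)))
      ; remaining = trans (vars≡ (frame n test τ) 6 refl) remaining
      ; progress  = skip-vertex I s (λ good kv → ≮⇒≥ λ many → 1+n≢0 (trans (sym val) (trans tested
          (⇒obstruction≡0 {τ} v<n (≡ᵇ-elim (subst T (marks v<n) kv))
            (subst (λ s → Good n β s v) (sym 4≡s) good) (subst (five k <_) (sym remaining) many))))) progress
      }
      where
      open Kept kept
      4≡s : vars τ 4 ≡ s
      4≡s = vars≡ F 4 refl
      tested : vars (run n test τ) 7 ≡ obstruction τ v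
      tested = test-correct τ v<n 10≡v (trans (vars≡ F 1 refl) 1≡k)
                 (stored-frame {C = delete} refl F st) (measured-frame {C = delete} refl refl F M)
    ... | zero = record
      { K         = without I s K v
      ; marks     = marks′
      ; remaining = begin
          vars (run n remove υ) 6              ≡⟨ vars≡ (frame n (for 11 mark) (setVar 6 (vars υ 6 ∸ vars υ 4) υ)) 6 refl ⟩
          vars υ 6 ∸ vars υ 4                  ≡⟨ cong₂ _∸_ (trans (vars≡ (frame n test τ) 6 refl) remaining)
                                                            (trans (vars≡ (frame n test τ) 4 refl) 4≡s) ⟩
          count n K ∸ s                        ≡⟨ cong (_∸ s) (delete-count I s v<n v∈K good progress) ⟩
          s + count n (without I s K v) ∸ s    ≡⟨ m+n∸m≡n s _ ⟩
          count n (without I s K v)            ∎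
      ; progress  = delete-vertex I s v<n v∈K good (subst (five k <_) remaining many) progress
      }
      where
      open Kept kept
      open ≡-Reasoning
      υ = run n test τ
      4≡s : vars τ 4 ≡ s
      4≡s = vars≡ F 4 refl
      Mτ : Measured τ
      Mτ = measured-frame {C = delete} refl refl F M
      stτ : Stored τ
      stτ = stored-frame {C = delete} refl F st
      tested : vars υ 7 ≡ obstruction τ v
      tested = test-correct τ v<n 10≡v (trans (vars≡ F 1 refl) 1≡k) stτ Mτ
      facts = obstruction≡0⇒ {τ} v<n (trans (sym tested) val) (Measured.bound Mτ)
      good : Good n β s v
      good = subst (λ s → Good n β s v) 4≡s (proj₁ (proj₂ facts))
      many : five k < vars τ 6
      many = proj₂ (proj₂ facts)
      v∈K : T (K v)
      v∈K = subst T (sym (marks v<n)) (≡ᵇ-intro (proj₁ facts))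
      marks′ : ∀ {u} → u < n → without I s K v u ≡ (arrays (run n remove υ) 1 u 0 ≡ᵇ 0)
      marks′ {u} u<n
        rewrite remove-correct υ v<n (trans (vars≡ (frame n test τ) 10 refl) 10≡v)
                  (stored-frame {C = test} refl (frame n test τ) stτ) u<n
              | arrays≡ (frame n test τ) 1 refl u 0
              | marks u<n = bits (arrays τ 1 u 0) (β v u)
        where
        bits : ∀ a b → (a ≡ᵇ 0) ∧ not b ≡ (a + bit b ≡ᵇ 0)
        bits zero    true  = refl
        bits zero    false = refl
        bits (suc _) _     = refl

  -- Variable 8 always holds the rank of the current vertex. Vertices listed earlier have smaller
  -- ranks, so their entries are not overwritten.
  enumerate-correct : ∀ σ K → (∀ {u} → u < n → K u ≡ (arrays σ 1 u 0 ≡ᵇ 0)) → vars σ 8 ≡ 0 →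
    ∀ {v} → v < n → T (K v) → arrays (run n enumerate σ) 3 (rank K v) 0 ≡ v
  enumerate-correct σ K marks 8≡0 = proj₂ (for-rule n 10 body σ Inv refl (8≡0 , λ ()) step)
    where
    body = unless (1 [ var 10 , lit 0 ]) list
    Inv : ℕ → State → Set
    Inv i τ = vars τ 8 ≡ rank K i ×
              (∀ {v} → v < i → T (K v) → arrays τ 3 (rank K v) 0 ≡ v)
    step : ∀ i τ → i < n → vars τ 10 ≡ i → Frame enumerate σ τ → Inv i τ →
      Inv (suc i) (tick 10 (run n body τ))
    step i τ i<n refl F (8≡r , listed) with arrays τ 1 i 0 in mark
    ... | suc _ = trans 8≡r (cong (λ b → bit b + rank K i) (sym dropped)) , listed′
      where
      dropped : K i ≡ false
      dropped = trans (marks i<n) (cong (_≡ᵇ 0) (trans (sym (arrays≡ F 1 refl i 0)) mark))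
      listed′ : ∀ {v} → v < suc i → T (K v) → arrays τ 3 (rank K v) 0 ≡ v
      listed′ {v} v<1+i kv with v ≟ i
      ... | yes refl = ⊥-elim (subst T dropped kv)
      ... | no v≢i   = listed (≤∧≢⇒< (s≤s⁻¹ v<1+i) v≢i) kv
    ... | zero rewrite 8≡r = cong (λ b → bit b + rank K i) (sym present) , listed′
      where
      present : K i ≡ true
      present = trans (marks i<n) (cong (_≡ᵇ 0) (trans (sym (arrays≡ F 1 refl i 0)) mark))
      listed′ : ∀ {v} → v < suc i → T (K v) → arrays (setCell 3 (rank K i) 0 i τ) 3 (rank K v) 0 ≡ v
      listed′ {v} v<1+i kv with v ≟ i
      ... | yes refl = setCell-same 3 (rank K i) 0 i τ
      ... | no v≢i   = trans
        (setCell-other-row 3 0 i τ 0 (<⇒≢ (rank-mono-< K kv v<i))) (listed v<i kv)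
        where v<i = ≤∧≢⇒< (s≤s⁻¹ v<1+i) v≢i

verdict : ℕ → ℕ → ℕ → ℕ
verdict k D m = let r = (D ∸ (k + k)) + (m ∸ five k) in ifZero (m ∸ (k + k)) (r + m) r

judge-correct : ∀ n τ → vars (run n judge τ) 9 ≡ verdict (vars τ 1) (vars τ 5) (vars τ 6)
judge-correct n τ with vars τ 6 ∸ (vars τ 1 + vars τ 1)
... | zero  = refl
... | suc _ = refl

verdict≡0⇒ : ∀ k D m → verdict k D m ≡ 0 → D ≤ k + k × m ≤ five k × (m ≤ k + k → m ≡ 0)
verdict≡0⇒ k D m eq with m ∸ (k + k) in few
... | zero  = m∸n≡0⇒m≤n (m+n≡0⇒m≡0 _ (m+n≡0⇒m≡0 _ eq)) ,
              m∸n≡0⇒m≤n (m+n≡0⇒n≡0 (D ∸ (k + k)) (m+n≡0⇒m≡0 _ eq)) ,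
              (λ _ → m+n≡0⇒n≡0 (D ∸ (k + k) + (m ∸ five k)) eq)
... | suc _ = m∸n≡0⇒m≤n (m+n≡0⇒m≡0 _ eq) ,
              m∸n≡0⇒m≤n (m+n≡0⇒n≡0 (D ∸ (k + k)) eq) ,
              (λ m≤2k → contradiction (trans (sym few) (m≤n⇒m∸n≡0 m≤2k)) λ ())

⇒verdict≡0 : ∀ k D m → D ≤ k + k → m ≤ five k → (m ≤ k + k → m ≡ 0) → verdict k D m ≡ 0
⇒verdict≡0 k D m small few empty
  rewrite m≤n⇒m∸n≡0 small | m≤n⇒m∸n≡0 few with m ∸ (k + k) in eq
... | zero  = empty (m∸n≡0⇒m≤n eq)
... | suc _ = refl

-- `b` will be the equality test on ranks, which agrees with equality of the vertices `x` and `y`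
-- because `pos` is injective.
strip-diagonal : ∀ {n} (G : Graph n) x y b → (T b → x ≡ y) → (x ≡ y → T b) →
  bit (neighbourhood G x y) ∸ bit b ≡ bit (0 <ᵇ matrix G x y)
strip-diagonal G x y true b⇒ _ with refl ← b⇒ _
  rewrite T⇒≡ (neighbourhood-refl G x) | matrix-irrefl G x = refl
strip-diagonal G x y false _ ⇒b with x ≡ᵇ y in eq
... | true  = ⊥-elim (⇒b (≡ᵇ-elim {x} (≡⇒T eq)))
... | false = refl

framed : ∀ n C {σ τ} → run n C σ ≡ τ → Frame C σ τ
framed n C {σ} refl = frame n C σ

Solves : Instance → State → Set
Solves I τ =
  (vars τ 9 ≡ 0 → Σ[ I′ ∈ Instance ] Outputs (setVar 0 (vars τ 6) τ) I′ × (UCEA I ⇔ UCEA I′) ×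
     order I′ ≤ five (param I) × param I′ ≤ param I) ×
  (vars τ 9 ≢ 0 → ¬ UCEA I)

-- The intermediate states are variables to keep them from being unfolded.
module Reduction (I : Instance) (5k<n : five (param I) < order I)
  {σ₁ σ₂ σ₃ σ₄ σ₅ σ₆ σ₇ τ : State}
  (run₁ : run (order I) closeUp (input I) ≡ σ₁)
  (run₂ : run (order I) measure σ₁ ≡ σ₂)
  (run₃ : run (order I) sumDeficit σ₂ ≡ σ₃)
  (run₄ : run (order I) (6 := var 0) σ₃ ≡ σ₄)
  (run₅ : run (order I) delete σ₄ ≡ σ₅)
  (run₆ : run (order I) enumerate σ₅ ≡ σ₆)
  (run₇ : run (order I) judge σ₆ ≡ σ₇)
  (run₈ : run (order I) induce σ₇ ≡ τ) where

  open Program I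

  F₁ : Frame closeUp (input I) σ₁
  F₁ = framed n closeUp run₁
  F₂ : Frame measure σ₁ σ₂
  F₂ = framed n measure run₂
  F₃ : Frame sumDeficit σ₂ σ₃
  F₃ = framed n sumDeficit run₃
  F₄ : Frame (6 := var 0) σ₃ σ₄
  F₄ = framed n (6 := var 0) run₄
  F₅ : Frame delete σ₄ σ₅
  F₅ = framed n delete run₅
  F₆ : Frame enumerate σ₅ σ₆
  F₆ = framed n enumerate run₆
  F₇ : Frame judge σ₆ σ₇
  F₇ = framed n judge run₇
  F₈ : Frame induce σ₇ τ
  F₈ = framed n induce run₈

  s : ℕ
  s = vars σ₂ 4

  D : ℕ
  D = deficit n β s

  stored₁ : Stored σ₁
  stored₁ = subst Stored run₁ (closeUp-correct (input I) λ _ _ → refl)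

  stored₂ : Stored σ₂
  stored₂ = stored-frame {C = measure} refl F₂ stored₁

  measured₂ : Measured σ₂
  measured₂ = subst Measured run₂ (measure-correct σ₁ stored₁ (vars≡ F₁ 4 refl))

  open Measured measured₂ using (bound; least)

  kept : Kept s n σ₅
  kept = subst₂ (λ s σ → Kept s n σ) (vars≡ (F₃ ▸ᶠ F₄) 4 refl) run₅
    (delete-correct σ₄ (vars≡ (F₁ ▸ᶠ F₂ ▸ᶠ F₃ ▸ᶠ F₄) 1 refl)
       (trans (cong (λ σ → vars σ 6) (sym run₄)) (vars≡ (F₁ ▸ᶠ F₂ ▸ᶠ F₃) 0 refl))
       (λ u → arrays≡ (F₁ ▸ᶠ F₂ ▸ᶠ F₃ ▸ᶠ F₄) 1 refl u 0) 5k<n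
       (stored-frame {C = sumDeficit ▸ 6 := var 0} refl (F₃ ▸ᶠ F₄) stored₂)
       (measured-frame {C = sumDeficit ▸ 6 := var 0} refl refl (F₃ ▸ᶠ F₄) measured₂))

  open Kept kept
  open Decision I s progress 5k<n bound least

  m : ℕ
  m = count n K

  pos : ℕ → ℕ
  pos p = arrays σ₆ 3 p 0

  pos-rank : ∀ {v} → v < n → T (K v) → pos (rank K v) ≡ v
  pos-rank {v} v<n kv = trans (cong (λ σ → arrays σ 3 (rank K v) 0) (sym run₆))
    (enumerate-correct σ₅ K marks (vars≡ (F₁ ▸ᶠ F₂ ▸ᶠ F₃ ▸ᶠ F₄ ▸ᶠ F₅) 8 refl) v<n kv)

  open Relabelling {s = s} K (Progress.stable progress) pos pos-rank using (unrank; pos-injective)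

  reduced : Instance
  reduced = kernel pos pos-rank

  m≤n : m ≤ n
  m≤n = subst (m ≤_) (count-everything n) (count-mono n {K} {everything} λ _ _ → _)

  stored₇ : Stored σ₇
  stored₇ = stored-frame {C = sumDeficit ▸ 6 := var 0 ▸ delete ▸ enumerate ▸ judge} refl
    (F₃ ▸ᶠ F₄ ▸ᶠ F₅ ▸ᶠ F₆ ▸ᶠ F₇) stored₂

  9≡verdict : vars τ 9 ≡ verdict k D m
  9≡verdict = trans (vars≡ F₈ 9 refl) (trans (cong (λ σ → vars σ 9) (sym run₇)) (trans (judge-correct n σ₆)
    (trans (cong₂ (λ k D → verdict k D (vars σ₆ 6)) 1≡k 5≡D) (cong (verdict k D) 6≡m))))
    where
    1≡k : vars σ₆ 1 ≡ k
    1≡k = vars≡ (F₁ ▸ᶠ F₂ ▸ᶠ F₃ ▸ᶠ F₄ ▸ᶠ F₅ ▸ᶠ F₆) 1 refl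
    5≡D : vars σ₆ 5 ≡ D
    5≡D = trans (vars≡ (F₄ ▸ᶠ F₅ ▸ᶠ F₆) 5 refl) (trans (cong (λ σ → vars σ 5) (sym run₃))
      (sumDeficit-correct σ₂ measured₂ (vars≡ (F₁ ▸ᶠ F₂) 5 refl)))
    6≡m : vars σ₆ 6 ≡ m
    6≡m = trans (vars≡ F₆ 6 refl) remaining

  accepted : verdict k D m ≡ 0 → (UCEA I ⇔ UCEA reduced) × order reduced ≤ five k
  accepted eq = let (small , few , empty) = verdict≡0⇒ k D m eq in
    kernel-correct pos pos-rank small empty , few

  rejected : verdict k D m ≢ 0 → ¬ UCEA I
  rejected neq yes! = neq (⇒verdict≡0 k D m (UCEA⇒deficit≤ yes!) (UCEA⇒count≤ yes!) (UCEA⇒count≡0 yes!))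

  outputs : Outputs (setVar 0 (vars τ 6) τ) reduced
  outputs .Outputs.order≡ = trans (vars≡ (F₆ ▸ᶠ F₇ ▸ᶠ F₈) 6 refl) remaining
  outputs .Outputs.param≡ = vars≡ (F₁ ▸ᶠ F₂ ▸ᶠ F₃ ▸ᶠ F₄ ▸ᶠ F₅ ▸ᶠ F₆ ▸ᶠ F₇ ▸ᶠ F₈) 1 refl
  outputs .Outputs.graph≡ u v = begin
    arrays τ 0 p q                                                          ≡⟨ cong (λ σ → arrays σ 0 p q) run₈ ⟨
    arrays (run n induce σ₇) 0 p q                                          ≡⟨ fill-correct n 0 _ σ₇ _ value
        (<-≤-trans p<m m≤n) (<-≤-trans q<m m≤n) ⟩
    arrays σ₇ 2 (arrays σ₇ 3 p 0) (arrays σ₇ 3 q 0) ∸ bit (p ≡ᵇ q)          ≡⟨ cong₂ (λ x y → arrays σ₇ 2 x y ∸ bit (p ≡ᵇ q)) (positions p) (positions q) ⟩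
    arrays σ₇ 2 (pos p) (pos q) ∸ bit (p ≡ᵇ q)                              ≡⟨ cong (_∸ bit (p ≡ᵇ q)) (stored₇ (proj₁ (unrank p<m)) (proj₁ (unrank q<m))) ⟩
    bit (β (pos p) (pos q)) ∸ bit (p ≡ᵇ q)                                  ≡⟨ strip-diagonal (graph I) (pos p) (pos q) _
        (λ e → cong pos (≡ᵇ-elim {p} e)) (λ e → ≡ᵇ-intro (pos-injective p<m q<m e)) ⟩
    bit (0 <ᵇ matrix (graph I) (pos p) (pos q))                             ∎
    where
    open ≡-Reasoning
    p = toℕ u
    q = toℕ v
    p<m : p < m
    p<m = toℕ<n u
    q<m : q < m
    q<m = toℕ<n v
    positions : ∀ p → arrays σ₇ 3 p 0 ≡ pos p
    positions p = arrays≡ F₇ 3 refl p 0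
    value : ∀ {i j} τ → i < n → j < n → vars τ 10 ≡ i → vars τ 11 ≡ j → Frame induce σ₇ τ →
      eval τ (2 [ 3 [ var 10 , lit 0 ] , 3 [ var 11 , lit 0 ] ] ⊖ equal (var 10) (var 11)) ≡
      arrays σ₇ 2 (arrays σ₇ 3 i 0) (arrays σ₇ 3 j 0) ∸ bit (i ≡ᵇ j)
    value {i} {j} τ _ _ refl refl F = cong₂ _∸_
      (trans (arrays≡ F 2 refl _ _)
             (cong₂ (arrays σ₇ 2) (arrays≡ F 3 refl i 0) (arrays≡ F 3 refl j 0)))
      (equal-bit i j)

  solves : Solves I τ
  solves =
    (λ 9≡0 → let (iff , few) = accepted (trans (sym 9≡verdict) 9≡0) in reduced , outputs , iff , few , ≤-refl) ,
    (λ 9≢0 → rejected λ eq → 9≢0 (trans 9≡verdict eq))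

reduce-solves : ∀ I → five (param I) < order I → Solves I (run (order I) reduce (input I))
reduce-solves I 5k<n = Reduction.solves I 5k<n refl refl refl refl refl refl refl refl

reduce-runs : ∀ I → five (param I) < order I →
  ∃[ t ] ∃[ τ ] (compile reduce , input I ⇓[ t ] τ) × t ≤ timeBound reduce (order I) ×
    vars τ 0 ≡ order I × Solves I τ
reduce-runs I 5k<n = let (t , ran , t≤) = exec (order I) reduce refl refl (input I) refl in
  t , run (order I) reduce (input I) , ran , t≤ ,
  vars≡ (frame (order I) reduce (input I)) 0 refl , reduce-solves I 5k<n

-- A fixed no-instance

oneEdge : Graph 3
oneEdge .adj u v      = toℕ u + toℕ v ≡ᵇ 1
oneEdge .adj-sym u v  = cong (_≡ᵇ 1) (+-comm (toℕ u) (toℕ v))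
oneEdge .adj-irrefl Fin.zero                      = refl
oneEdge .adj-irrefl (Fin.suc Fin.zero)            = refl
oneEdge .adj-irrefl (Fin.suc (Fin.suc Fin.zero))  = refl

noInstance : Instance
noInstance .order   = 3
noInstance .graph   = oneEdge
noInstance .param   = 1
noInstance .param>0 = s≤s z≤n

-- The edge forces size at least 2. Size 2 fails by parity: vertices 0 and 1 share a class, so the
-- class of vertex 2 has 1 or 3 elements. From size 3 on the deficit exceeds 2.
noInstance-correct : ¬ UCEA noInstance
noInstance-correct yes! with UCEA⇒Fits noInstance yes!
... | s , P , small = absurd s P (packing⇒degree≤ P (s≤s z≤n)) small
  where
  absurd : ∀ s → Packing 3 everything (neighbourhood oneEdge) s → 2 ≤ s →
    (s ∸ 1) + ((s ∸ 2) + ((s ∸ 2) + 0)) ≤ 2 → ⊥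
  absurd 2 P _ _ = odd (colour 2 ≡ᵇ colour 2) (colour 0 ≡ᵇ colour 2) (T⇒≡ (≡ᵇ-intro {colour 2} refl))
    (trans (cong (λ c → bit (colour 2 ≡ᵇ colour 2) + (bit (c ≡ᵇ colour 2) + (bit (colour 0 ≡ᵇ colour 2) + 0)))
                 (respects {0} {1} (s≤s z≤n) (s≤s (s≤s z≤n)) _ _ _))
           (classSize {2} (s≤s (s≤s (s≤s z≤n))) _))
    where
    open Packing P
    odd : ∀ a b → a ≡ true → bit a + (bit b + (bit b + 0)) ≢ 2
    odd true true  _ ()
    odd true false _ ()
  absurd (suc zero) P (s≤s ()) _
  absurd (suc (suc (suc s))) P _ le =
    <⇒≱ (s≤s (s≤s (subst (1 ≤_) (sym (+-suc s _)) (s≤s z≤n)))) le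

refuse : Cmd
refuse = fill 0 (equal (var 10 ⊕ var 11) (lit 1))

-- The loops still run up to the old order `n`, which must be at least 3 for the whole new matrix to
-- be written.
refuse-correct : ∀ n σ → vars σ 0 ≡ n → 3 ≤ n → ∃[ t ] ∃[ τ ]
  ((compile refuse ⨾ 0 ≔ lit 3 ⨾ 1 ≔ lit 1) , σ ⇓[ t ] τ) × t ≤ timeBound refuse n + 4 × Outputs τ noInstance
refuse-correct n σ 0≡n 3≤n = let (t , ran , t≤) = exec n refuse refl refl σ 0≡n in
  t + 4 , _ , seq ran (seq assign assign) , +-monoˡ-≤ 4 t≤ , record
    { order≡ = refl
    ; param≡ = refl
    ; graph≡ = λ u v → fill-correct n 0 _ σ (λ i j → bit (i + j ≡ᵇ 1)) value
        (<-≤-trans (toℕ<n u) 3≤n) (<-≤-trans (toℕ<n v) 3≤n)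
    }
  where
  value : ∀ {i j} τ → i < n → j < n → vars τ 10 ≡ i → vars τ 11 ≡ j → Frame refuse σ τ →
    eval τ (equal (var 10 ⊕ var 11) (lit 1)) ≡ bit (i + j ≡ᵇ 1)
  value {i} {j} τ _ _ refl refl _ = equal-bit (i + j) 1

-- The kernelization and its running time

kernelize : Prog
kernelize =
  If var 0 ⊖ fiveK
  -- Variable 0 bounds every loop, so it receives the new order only after the last loop.
  Then (compile reduce ⨾ If var 9 Then (compile refuse ⨾ 0 ≔ lit 3 ⨾ 1 ≔ lit 1) Else (0 ≔ var 6))
  Else skip

five≡5* : ∀ k → five k ≡ 5 * k
five≡5* = expand
  where
  expand : ∀ k → k + k + k + k + k ≡ 5 * k
  expand = solve-∀

n<size : ∀ I → suc (order I) ≤ size I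
n<size I = subst (_≤ size I) (+-comm (order I) 1) (+-mono-≤ (n≤n*n (order I)) (s≤s z≤n))
  where
  n≤n*n : ∀ n → n ≤ n * n
  n≤n*n zero    = z≤n
  n≤n*n (suc n) = m≤m*n (suc n) (suc n)

Kernelizes : Instance → Set
Kernelizes I = ∃[ t ] ∃[ τ ] Σ[ I′ ∈ Instance ]
  (kernelize , input I ⇓[ t ] τ) × Outputs τ I′ × t ≤ timeBound (reduce ▸ refuse) (order I) + 18 ×
  (UCEA I ⇔ UCEA I′) × order I′ ≤ five (param I) × param I′ ≤ param I

kernelize-correct : ∀ I → Kernelizes I
kernelize-correct I with order I ∸ five (param I) in large
... | zero = _ , input I , I , if-false large skip ,
  record { order≡ = refl ; param≡ = refl ; graph≡ = matrix-toℕ (graph I) } ,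
  ≤-trans (m≤m+n 13 5) (m≤n+m 18 (timeBound (reduce ▸ refuse) (order I))) ,
  mk⇔ id id , m∸n≡0⇒m≤n large , ≤-refl
... | suc _ = answer (reduce-runs I 5k<n)
  where
  5k<n : five (param I) < order I
  5k<n = ≰⇒> λ le → 1+n≢0 (trans (sym large) (m≤n⇒m∸n≡0 le))
  large≢0 : order I ∸ five (param I) ≢ 0
  large≢0 eq = 1+n≢0 (trans (sym large) eq)
  5≤5k : 5 ≤ five (param I)
  5≤5k = ≤-trans (*-monoʳ-≤ 5 (param>0 I)) (≤-reflexive (sym (five≡5* (param I))))
  3≤5k : 3 ≤ five (param I)
  3≤5k = ≤-trans (m≤m+n 3 2) 5≤5k
  R₁ = timeBound reduce (order I)
  R₂ = timeBound refuse (order I)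
  -- The 18 consists of 12 for the outer test, 2 for the test of variable 9 and 4 for the two
  -- assignments after `refuse`.
  time≤ : ∀ {t u} → t ≤ R₁ → u ≤ R₂ + 4 → suc (11 + (t + suc (1 + u))) ≤ R₁ + R₂ + 18
  time≤ {t} {u} t≤ u≤ = begin
    suc (11 + (t + suc (1 + u)))             ≤⟨ +-monoʳ-≤ 12 (+-mono-≤ t≤ (+-monoʳ-≤ 2 u≤)) ⟩
    suc (11 + (R₁ + suc (1 + (R₂ + 4))))     ≡⟨ arith R₁ R₂ ⟩
    R₁ + R₂ + 18                             ∎
    where
    open ≤-Reasoning
    arith : ∀ t u → suc (11 + (t + suc (1 + (u + 4)))) ≡ t + u + 18
    arith = solve-∀
  answer : (∃[ t ] ∃[ τ ] (compile reduce , input I ⇓[ t ] τ) × t ≤ R₁ ×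
              vars τ 0 ≡ order I × Solves I τ) → Kernelizes I
  answer (t , τ , ran , t≤ , 0≡n , yea , nay) with vars τ 9 ≟ 0
  ... | yes 9≡0 = let (I′ , outs , iff , few , param≤) = yea 9≡0 in
    _ , _ , I′ , if-true large≢0 (seq ran (if-false 9≡0 assign)) , outs ,
    time≤ t≤ (≤-trans (m≤m+n 2 2) (m≤n+m 4 R₂)) , iff , few , param≤
  ... | no 9≢0 =
    let (u , υ , wrote , u≤ , outs) = refuse-correct (order I) τ 0≡n (≤-trans 3≤5k (<⇒≤ 5k<n)) in
    _ , υ , noInstance , if-true large≢0 (seq ran (if-true 9≢0 wrote)) , outs , time≤ t≤ u≤ ,
    mk⇔ (λ yes! → contradiction yes! (nay 9≢0)) (λ yes! → contradiction yes! noInstance-correct) ,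
    3≤5k , param>0 I

theorem61 : HasKernelWithVertices UCEA (λ k → 5 * k)
theorem61 = kernelize , c + 18 , d , id , (skip , λ k → 1 , numberInput k , skip , refl) , λ I →
  let (t , τ , I′ , ran , outs , t≤ , iff , few , param≤) = kernelize-correct I in
  t , τ , I′ , ran , outs , ≤-trans t≤ (polynomial I) , iff , subst (order I′ ≤_) (five≡5* (param I)) few , param≤
  where
  bound = timeBound-polynomial (reduce ▸ refuse)
  c = proj₁ bound
  d = proj₁ (proj₂ bound)
  polynomial : ∀ I → timeBound (reduce ▸ refuse) (order I) + 18 ≤ (c + 18) * size I ^ d + (c + 18)
  polynomial I = begin
    timeBound (reduce ▸ refuse) (order I) + 18         ≤⟨ +-mono-≤ (proj₂ (proj₂ bound) (order I)) (m≤n+m 18 c) ⟩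
    -- The required form has one constant as both factor and summand, so the factor is enlarged to
    -- `c + 18`.
    c * suc (order I) ^ d + (c + 18)        ≤⟨ +-monoˡ-≤ (c + 18) (*-mono-≤ (m≤m+n c 18) (^-monoˡ-≤ d (n<size I))) ⟩
    (c + 18) * size I ^ d + (c + 18)        ∎
    where open ≤-Reasoning
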